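{- Every subcubic planar graph with girth at least $12$ has a $(1,2^5)$-packing edge-coloring.
   Context: Graphs are finite and simple. A graph is subcubic if its maximum degree is at most $3$. The girth of a graph is the length of a shortest cycle, with the girth of a forest taken to be infinite. For distinct edges $e,f$ of $G$, the distance between $e$ and $f$ is the distance between the corresponding vertices of the line graph $L(G)$ (so edges sharing an endpoint are at distance $1$). A $(1^j,2^k)$-packing edge-coloring of $G$ is a partition of $E(G)$ into $j+k$ classes (possibly empty) such that in each of the first $j$ classes any two distinct edges are at distance at least $2$ (the class is a matching), and in each of the remaining $k$ classes any two distinct edges are at distance at least $3$ (the class is an induced matching). Thus a $(1,2^5)$-packing edge-coloring is a partition of $E(G)$ into one matching and five induced matchings. -}

module Defs where

open import Level using (0ℓ)
open import Data.Bool.Base using (Bool; T)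
open import Data.Nat.Base using (ℕ; suc; _+_; _*_; _≤_)
open import Data.Fin.Base using (Fin; zero; suc; inject₁; fromℕ; _<_)
open import Data.Fin.Subset using (Subset; ∣_∣)
open import Data.Vec.Base using (tabulate)
open import Data.Product.Base using (∃; _×_)
open import Data.Sum.Base using (_⊎_; inj₁; inj₂)
open import Function.Base using (_∘_)
open import Function.Bundles using (_↔_; _⇔_; module Inverse)
open import Function.Definitions using (Injective; StrictlySurjective)
open import Relation.Binary.Core using (Rel)
open import Relation.Binary.Definitions using (Symmetric)
open import Relation.Binary.Construct.Closure.ReflexiveTransitive using (Star; ε; _◅_)
open import Relation.Binary.Construct.Closure.Equivalence using (EqClosure)
open import Relation.Binary.Construct.Union using (_∪_)
open import Relation.Binary.PropositionalEquality.Core using (_≡_; _≢_)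
open import Relation.Nullary.Negation.Core using (¬_)

private
  variable
    A : Set

record Graph : Set where
  field
    order : ℕ
    adj   : Fin order → Fin order → Bool

  Vertex : Set
  Vertex = Fin order

  Adj : Rel Vertex 0ℓ
  Adj u v = T (adj u v)

  field
    adj-sym    : Symmetric Adj
    adj-irrefl : ∀ v → ¬ Adj v v

  neighbours : Vertex → Subset order
  neighbours v = tabulate (adj v)

  degree : Vertex → ℕ
  degree v = ∣ neighbours v ∣

  -- Each unordered edge is represented once, its ends listed in increasing order.
  record Edge : Set where
    field
      lo hi    : Vertex
      lo<hi    : lo < hi
      adjacent : Adj lo hi

  _∈ᵉ_ : Vertex → Edge → Set
  v ∈ᵉ e = v ≡ Edge.lo e ⊎ v ≡ Edge.hi e

  LineAdj : Rel Edge 0ℓ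
  LineAdj e f = e ≢ f × ∃ λ v → v ∈ᵉ e × v ∈ᵉ f

  -- An edge with a chosen direction.
  record Dart : Set where
    field
      tail head : Vertex
      adjacent  : Adj tail head

  reverse : Dart → Dart
  reverse d = record
    { tail = Dart.head d ; head = Dart.tail d ; adjacent = adj-sym (Dart.adjacent d) }

  record Cycle : Set where
    field
      extra    : ℕ
      vertex   : Fin (3 + extra) → Vertex
      distinct : Injective _≡_ _≡_ vertex
      step     : ∀ (i : Fin (2 + extra)) → Adj (vertex (inject₁ i)) (vertex (suc i))
      close    : Adj (vertex (fromℕ (2 + extra))) (vertex zero)

    cycleLength : ℕ
    cycleLength = 3 + extra

open Graph

Subcubic : Graph → Set
Subcubic G = ∀ v → degree G v ≤ 3

-- Vacuously true of forests, whose girth is infinite.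
GirthAtLeast : ℕ → Graph → Set
GirthAtLeast g G = ∀ (c : Cycle G) → g ≤ Cycle.cycleLength c

walkLength : {R : Rel A 0ℓ} {x y : A} → Star R x y → ℕ
walkLength ε       = 0
walkLength (_ ◅ w) = suc (walkLength w)

-- The distance from x to y in the graph of R is at least k; elements in
-- different components are at infinite distance.
DistanceAtLeast : Rel A 0ℓ → ℕ → A → A → Set
DistanceAtLeast R k x y = ∀ (w : Star R x y) → k ≤ walkLength w

record PackingEdgeColoring (j k : ℕ) (G : Graph) : Set where
  field
    color : Edge G → Fin j ⊎ Fin k
    matching :
      ∀ i {e f} → color e ≡ inj₁ i → color f ≡ inj₁ i → e ≢ f →
      DistanceAtLeast (LineAdj G) 2 e f
    inducedMatching :
      ∀ i {e f} → color e ≡ inj₂ i → color f ≡ inj₂ i → e ≢ f →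
      DistanceAtLeast (LineAdj G) 3 e f

-- Planarity is expressed by combinatorial maps: an embedding of a graph is
-- recorded by the cyclic order of the darts leaving each vertex, and it is an
-- embedding in the sphere exactly when Euler's formula holds.

Steps : (A → A) → Rel A 0ℓ
Steps f x y = f x ≡ y

-- The equivalence relation generated by R has exactly k classes.
record ClassCount (R : Rel A 0ℓ) (k : ℕ) : Set where
  field
    class : A → Fin k
    onto  : StrictlySurjective _≡_ class
    exact : ∀ x y → EqClosure R x y ⇔ class x ≡ class y

record RotationSystem (G : Graph) : Set where
  field
    rotation : Dart G ↔ Dart G

  rotate : Dart G → Dart G
  rotate = Inverse.to rotation

  field
    rotate-tail : ∀ d → Dart.tail (rotate d) ≡ Dart.tail d
    -- The darts leaving a vertex form a single cycle of the rotation.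
    cyclic : ∀ d e → Dart.tail d ≡ Dart.tail e → EqClosure (Steps rotate) d e

  -- The orbits of this permutation are the boundary walks of the faces.
  traceFace : Dart G → Dart G
  traceFace = rotate ∘ reverse G

-- Everything is counted on darts: vertices, edges and faces are the orbits of
-- rotate, reverse and traceFace, and components are the orbits of rotate and
-- reverse jointly. Isolated vertices carry no dart and are not counted, which
-- does not affect planarity. Each component has Euler characteristic at most 2,
-- so the summed formula V + F = E + 2C says that every component has genus 0.
record PlanarEmbedding (G : Graph) : Set where
  field
    rotationSystem : RotationSystem G

  open RotationSystem rotationSystem public

  field
    V E F C    : ℕ
    vertices   : ClassCount (Steps rotate) V
    edges      : ClassCount (Steps (reverse G)) E
    faces      : ClassCount (Steps traceFace) F
    components : ClassCount (Steps rotate ∪ Steps (reverse G)) C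
    euler      : V + F ≡ E + 2 * C

Planar : Graph → Set
Planar = PlanarEmbedding

-- Colour the edges of ever larger sets S of edges of G, giving every vertex a
-- palette of three colours that contains the matching colour, so that across
-- an edge the palettes share at most the matching colour and the colour of the
-- edge. A minimal uncoloured S has no leaf, no path of three 2-vertices, and
-- no 3-vertex whose threads begin with 2-vertices in the pattern (2,2,0) or
-- (2,1,1): delete the configuration, let its boundary edges take a colour still
-- free in the palettes of their outer ends, and rebuild it. Hence the threads
-- at a 3-vertex have at most three 2-vertices in total, and discharging gives
-- 12 n ≤ 10 |S|, where n is the number of non-isolated vertices of S.
--
-- Planarity gives the opposite. Let c be the number of components of S and f
-- the number of regions into which S cuts the surface. The inequality
-- V + f ≥ |S| + c + C holds for the full edge set by Euler's formula, and it
-- survives the deletion of an edge: a bridge of S has the same region on both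
-- sides, and any other edge separates at most two regions. The boundary of a
-- region is a walk that never turns back, so by the girth it has twelve darts.
module Submission where

-- Palettes make the distance condition local. Compatibility concerns one edge at a time, so a
-- deleted configuration meets the remaining colouring only through the palette and one free colour
-- of each outer end, and the rebuilding becomes a choice among five strong colours.
--
-- If every region has at least g boundary darts, Euler's formula keeps the average degree below
-- 2g/(g - 2), which is 12/5 for g = 12. Against 12/5 a 2-vertex lacks 2/5 and a 3-vertex has 3/5 to
-- spare. When each 2-vertex receives 1/5 from both ends of its thread, a 3-vertex can therefore
-- serve three 2-vertices; the configurations are the ways to exceed three. Scaling by five gives
-- the integers used below.
--
-- The girth has a second use: the vertices of a configuration lie on trails of at most seven
-- vertices, so they are distinct and the outer ends are not part of the configuration.
--
-- No embedding of a subgraph is ever built. `S` stays a set of darts of one fixed map, and only its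
-- numbers of components and regions change. Since all configurations are decidable, the minimal
-- uncoloured `S` becomes a recursion on the number of edges.

open import Defs
open import Data.Bool.Base using (Bool; true; false; T; _∧_; _∨_; if_then_else_)
open import Data.Bool.Properties using (T?; T-∧; T-∨; T-irrelevant)
open import Data.Empty using (⊥)
open import Data.Fin.Base using (Fin; zero; suc; toℕ; punchIn; punchOut; _<_)
open import Data.Fin.Properties as Fin
  using (any?; pigeonhole; injective⇒≤; +↔⊎; *↔×; 1↔⊤; 0↔⊥; 2↔Bool; punchOut-injective;
    punchOut-cong; punchOut-punchIn; punchInᵢ≢i; toℕ-injective; toℕ-inject₁; toℕ-fromℕ; toℕ<n)
open import Data.Fin.Subset using (∣_∣)
open import Data.List.Base using (List; []; _∷_; length; lookup)
import Data.List.Membership.DecPropositional as DecMembership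
open import Data.List.Membership.Propositional using (_∈_; _∉_)
open import Data.List.Membership.Propositional.Properties using (∈-lookup; ∈-++⁺ˡ)
open import Data.List.Relation.Unary.All as All using (All; []; _∷_)
open import Data.List.Relation.Unary.All.Properties using (¬Any⇒All¬)
open import Data.List.Relation.Unary.AllPairs using ([]; _∷_)
open import Data.List.Relation.Unary.Any using (here; there; index)
open import Data.List.Relation.Unary.Any.Properties using (lookup-index)
open import Data.List.Relation.Unary.Unique.Propositional using (Unique)
open import Data.Maybe.Base using (Maybe; just; nothing)
open import Data.Maybe.Properties as Maybe using (just-injective)
open import Data.Nat.Base as ℕ using (ℕ; zero; suc; _+_; _*_; _∸_; _≤_; z≤n; s≤s; z<s; s<s)
open import Data.Nat.Properties as ℕ using ()
open import Data.Nat.Solver using (module +-*-Solver)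
open import Data.Product.Base using (Σ; ∃; ∃₂; _×_; _,_; proj₁; proj₂; map₂)
open import Data.Product.Function.NonDependent.Propositional using (_×-↔_)
open import Data.Product.Properties using (,-injectiveˡ; ,-injectiveʳ)
open import Data.Sum.Base as Sum using (_⊎_; inj₁; inj₂; [_,_]′)
open import Data.Sum.Function.Propositional using (_⊎-↔_)
open import Data.Sum.Properties using (inj₁-injective; inj₂-injective)
open import Data.Unit.Base using (⊤; tt)
open import Data.Vec.Base using (tabulate)
open import Function.Base using (_∘_; id)
open import Function.Bundles
  using (_↔_; mk↔ₛ′; mk⇔; module Inverse; module Injection; module Equivalence)
open import Function.Construct.Composition using (_↔-∘_)
open import Function.Construct.Identity using (↔-id)
open import Function.Construct.Symmetry using (↔-sym)
open import Function.Definitions using (Injective)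
open import Function.Properties.Inverse using (↔⇒↣)
open import Level using (0ℓ)
open import Relation.Binary.Construct.Closure.Equivalence as Eq using (EqClosure)
open import Relation.Binary.Construct.Closure.ReflexiveTransitive using (Star; ε; _◅_; _◅◅_)
open import Relation.Binary.Construct.Closure.Symmetric using (SymClosure; fwd; bwd)
open import Relation.Binary.Construct.Union using (_∪_)
open import Relation.Binary.Core using (Rel; _⇒_)
open import Relation.Binary.Definitions using (DecidableEquality; Symmetric)
open import Relation.Binary.PropositionalEquality
  using (_≡_; _≢_; refl; sym; trans; cong; cong₂; subst; subst₂; ≢-sym)
open import Relation.Nullary using (Dec; yes; no; ¬_; contradiction)
open import Relation.Nullary.Decidable
  using (isYes; isNo; toWitness; fromWitness; toWitnessFalse; fromWitnessFalse; decidable-stable;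
    via-injection; ¬?; _×-dec_; _⊎-dec_)
open import Algebra.Properties.CommutativeMonoid.Sum ℕ.+-0-commutativeMonoid
  using (sum; ∑-distrib-+)
open import Algebra.Properties.Semiring.Sum ℕ.+-*-semiring using (*-distribˡ-sum)

-- Finite cardinalities

private
  variable
    A B : Set
    k l m n : ℕ

Size : Set → ℕ → Set
Size A k = A ↔ Fin k

↔-injective : (a : A ↔ B) → Injective _≡_ _≡_ (Inverse.to a)
↔-injective a = Injection.injective (↔⇒↣ a)

-- Most counting inequalities below come from here, by an explicit injection between sized types.
size-mono : Size A k → Size B l → (f : A → B) → Injective _≡_ _≡_ f → k ≤ l
size-mono a b f f-inj = injective⇒≤ {f = to b ∘ f ∘ from a} λ eq →
  ↔-injective (↔-sym a) (f-inj (↔-injective b eq))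
  where open Inverse

size-⊎ : Size A k → Size B l → Size (A ⊎ B) (k + l)
size-⊎ a b = ↔-sym +↔⊎ ↔-∘ (a ⊎-↔ b)

size-× : Size A k → Size B l → Size (A × B) (k * l)
size-× a b = ↔-sym *↔× ↔-∘ (a ×-↔ b)

size-⊤ : Size ⊤ 1
size-⊤ = ↔-sym 1↔⊤

Σ-suc : (B : Fin (suc n) → Set) → Σ (Fin (suc n)) B ↔ (B zero ⊎ Σ (Fin n) (B ∘ suc))
Σ-suc B = mk↔ₛ′
  (λ { (zero , b) → inj₁ b ; (suc i , b) → inj₂ (i , b) })
  (λ { (inj₁ b) → zero , b ; (inj₂ (i , b)) → suc i , b })
  (λ { (inj₁ _) → refl ; (inj₂ _) → refl })
  (λ { (zero , _) → refl ; (suc _ , _) → refl })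

size-Σ : {B : Fin n → Set} {f : Fin n → ℕ} → (∀ i → Size (B i) (f i)) → Size (Σ (Fin n) B) (sum f)
size-Σ {n = ℕ.zero} _ = mk↔ₛ′ (λ ()) (λ ()) (λ ()) (λ ())
size-Σ {n = suc n}  b = size-⊎ (b zero) (size-Σ (b ∘ suc)) ↔-∘ Σ-suc _

indicator : Bool → ℕ
indicator b = if b then 1 else 0

size-T : ∀ b → Size (T b) (indicator b)
size-T true  = size-⊤
size-T false = ↔-sym 0↔⊥

opaque

  count : (Fin n → Bool) → ℕ
  count P = sum (indicator ∘ P)

  count≡sum : (P : Fin n → Bool) → count P ≡ sum (indicator ∘ P)
  count≡sum P = refl

  size-count : (P : Fin n → Bool) → Size (Σ (Fin n) (T ∘ P)) (count P)
  size-count P = size-Σ (size-T ∘ P)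

  count-tabulate : (P : Fin n → Bool) → count P ≡ ∣ tabulate P ∣
  count-tabulate {ℕ.zero} P = refl
  count-tabulate {suc n} P with P zero | count-tabulate (P ∘ suc)
  ... | true  | eq = cong suc eq
  ... | false | eq = eq

Σ-T-≡ : {P : A → Bool} {x y : A} {p : T (P x)} {q : T (P y)} →
        x ≡ y → _≡_ {A = Σ A (T ∘ P)} (x , p) (y , q)
Σ-T-≡ refl = cong (_ ,_) (T-irrelevant _ _)

size-subtype : Size A k → (P : A → Bool) → ∃ (Size (Σ A (T ∘ P)))
size-subtype a P = _ , size-count (P ∘ from) ↔-∘
  mk↔ₛ′
    (λ (x , p) → to x , subst (T ∘ P) (sym (strictlyInverseʳ x)) p)
    (λ (i , p) → from i , p)
    (λ (i , p) → Σ-T-≡ (strictlyInverseˡ i))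
    (λ (x , p) → Σ-T-≡ (strictlyInverseʳ x))
  where
  open Inverse a

ΣΣ-T-≡ : {P : A → B → Bool} {x x′ : A} {y y′ : B} {p : T (P x y)} {q : T (P x′ y′)} → x ≡ x′ → y ≡ y′ →
         _≡_ {A = Σ A λ x → Σ B (T ∘ P x)} (x , y , p) (x′ , y′ , q)
ΣΣ-T-≡ refl refl = cong (_ ,_) (Σ-T-≡ refl)

sum-mono : {f g : Fin n → ℕ} → (∀ i → f i ≤ g i) → sum f ≤ sum g
sum-mono {ℕ.zero} _ = z≤n
sum-mono {suc n}  h = ℕ.+-mono-≤ (h zero) (sum-mono (h ∘ suc))

-- If every value of `g` lay in `xs`, its position there would inject `Fin k` into the positions of
-- `xs`.
fresh : DecidableEquality A → (g : Fin k → A) → Injective _≡_ _≡_ g →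
        (xs : List A) → length xs ℕ.< k → ∃ λ i → g i ∉ xs
fresh _≟_ g g-inj xs l<k with any? (λ i → ¬? (g i ∈? xs))
  where open DecMembership _≟_ using (_∈?_)
... | yes found = found
... | no none = contradiction l<k (ℕ.≤⇒≯ (injective⇒≤ index-injective))
  where
  open DecMembership _≟_ using (_∈?_)
  member : ∀ i → g i ∈ xs
  member i = decidable-stable (g i ∈? xs) λ ∉xs → none (i , ∉xs)
  index-injective : Injective _≡_ _≡_ (index ∘ member)
  index-injective {i} {j} eq = g-inj
    (trans (lookup-index (member i)) (trans (cong (lookup xs) eq) (sym (lookup-index (member j)))))

lookup-injective : {xs : List A} → Unique xs → Injective _≡_ _≡_ (lookup xs)
lookup-injective (_ ∷ _)    {zero}  {zero}  _  = refl
lookup-injective (x∉xs ∷ _) {zero}  {suc j} eq = contradiction eq (All.lookup x∉xs (∈-lookup j))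
lookup-injective (x∉xs ∷ _) {suc i} {zero}  eq = contradiction (sym eq) (All.lookup x∉xs (∈-lookup i))
lookup-injective (_ ∷ u)    {suc i} {suc j} eq = cong suc (lookup-injective u eq)

count-fresh : (P : Fin n → Bool) (xs : List (Fin n)) → length xs ℕ.< count P →
              ∃ λ x → T (P x) × x ∉ xs
count-fresh P xs l<
  with fresh Fin._≟_ (proj₁ ∘ from) (λ eq → ↔-injective (↔-sym (size-count P)) (Σ-T-≡ eq)) xs l<
  where open Inverse (size-count P)
... | i , ∉xs = _ , proj₂ (Inverse.from (size-count P) i) , ∉xs

unique⇒length≤count : (P : Fin n → Bool) {xs : List (Fin n)} → Unique xs → All (T ∘ P) xs →
                      length xs ≤ count P
unique⇒length≤count P {xs} u ps = size-mono (↔-id _) (size-count P)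
  (λ i → lookup xs i , All.lookup ps (∈-lookup i))
  (λ eq → lookup-injective u (cong proj₁ eq))

-- A member outside `xs` would extend it to a duplicate-free list that is too long. This turns a
-- degree bound into a complete list of neighbours.
count-cover : (P : Fin n → Bool) {xs : List (Fin n)} → Unique xs → All (T ∘ P) xs →
              count P ≤ length xs → ∀ {y} → T (P y) → y ∈ xs
count-cover P {xs} u ps c≤ {y} p = decidable-stable (y ∈? xs) λ y∉xs →
  ℕ.≤⇒≯ c≤ (unique⇒length≤count P (¬Any⇒All¬ xs y∉xs ∷ u) (p ∷ ps))
  where open DecMembership Fin._≟_ using (_∈?_)

count-mono : ∀ {n} {P Q : Fin n → Bool} → (∀ {i} → T (P i) → T (Q i)) → count P ≤ count Q
count-mono {P = P} {Q} P⇒Q = size-mono (size-count P) (size-count Q) (map₂ P⇒Q) (Σ-T-≡ ∘ cong proj₁)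

count-none : ∀ {n} {P : Fin n → Bool} → (∀ {i} → ¬ T (P i)) → count P ≡ 0
count-none {P = P} none = ℕ.n<1⇒n≡0 (ℕ.≰⇒> λ 0<c → none (proj₁ (proj₂ (count-fresh P [] 0<c))))

-- Numbers of classes

private
  variable
    R R′ : Rel A 0ℓ

-- Its union with a relation glues two classes; every change of a class count below is reduced to
-- such gluings.
Pair : A → A → Rel A 0ℓ
Pair x y a b = x ≡ a × y ≡ b

single : R ⇒ EqClosure R
single r = fwd r ◅ ε

eq-bind : R ⇒ EqClosure R′ → EqClosure R ⇒ EqClosure R′
eq-bind = Eq.fold (Eq.isEquivalence _)

module Classes {A : Set} {R : Rel A 0ℓ} {k : ℕ} (cc : ClassCount R k) where
  open ClassCount cc public

  rep : Fin k → A
  rep i = proj₁ (onto i)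

  class-rep : ∀ i → class (rep i) ≡ i
  class-rep i = proj₂ (onto i)

  ~⇒≡ : ∀ {x y} → EqClosure R x y → class x ≡ class y
  ~⇒≡ = Equivalence.to (exact _ _)

  ≡⇒~ : ∀ {x y} → class x ≡ class y → EqClosure R x y
  ≡⇒~ = Equivalence.from (exact _ _)

  step : ∀ {x y} → R x y → class x ≡ class y
  step = ~⇒≡ ∘ single

  rep~ : ∀ x → EqClosure R (rep (class x)) x
  rep~ x = ≡⇒~ (class-rep (class x))

-- Representatives of distinct `R′`-classes lie in distinct `R`-classes.
classCount-anti : R ⇒ EqClosure R′ → ClassCount R k → ClassCount R′ l → l ≤ k
classCount-anti R⇒ c c′ = Fin.injective⇒≤ {f = λ i → C.class (C′.rep i)} λ {i} {j} eq →
  trans (sym (C′.class-rep i)) (trans (C′.~⇒≡ (eq-bind R⇒ (C.≡⇒~ eq))) (C′.class-rep j))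
  where
  module C = Classes c
  module C′ = Classes c′

classCount-transport : R ⇒ EqClosure R′ → R′ ⇒ EqClosure R → ClassCount R k → ClassCount R′ k
classCount-transport R⇒ R′⇒ c = record
  { class = class
  ; onto  = onto
  ; exact = λ x y → mk⇔ (~⇒≡ ∘ eq-bind R′⇒) (eq-bind R⇒ ∘ ≡⇒~)
  }
  where open Classes c

-- One use of the added pair is enough: two uses in a walk cancel or collapse into one.
join-pair : ∀ {R : Rel A 0ℓ} {x y a b} → EqClosure (R ∪ Pair x y) a b →
            EqClosure R a b ⊎ (EqClosure R a x × EqClosure R b y) ⊎ (EqClosure R a y × EqClosure R b x)
join-pair {R = R} ε = inj₁ ε
join-pair {R = R} {x} {y} {a} (s ◅ w) = extend s (join-pair w)
  where
  _⁻¹ : ∀ {u v} → EqClosure R u v → EqClosure R v u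
  _⁻¹ = Eq.symmetric R
  extend : ∀ {c b} → SymClosure (R ∪ Pair x y) a c →
           EqClosure R c b ⊎ (EqClosure R c x × EqClosure R b y) ⊎ (EqClosure R c y × EqClosure R b x) →
           EqClosure R a b ⊎ (EqClosure R a x × EqClosure R b y) ⊎ (EqClosure R a y × EqClosure R b x)
  extend (fwd (inj₁ r)) = Sum.map (fwd r ◅_) (Sum.map (λ (p , q) → fwd r ◅ p , q) (λ (p , q) → fwd r ◅ p , q))
  extend (bwd (inj₁ r)) = Sum.map (bwd r ◅_) (Sum.map (λ (p , q) → bwd r ◅ p , q) (λ (p , q) → bwd r ◅ p , q))
  extend (fwd (inj₂ (refl , refl))) (inj₁ p)              = inj₂ (inj₁ (ε , p ⁻¹))
  extend (fwd (inj₂ (refl , refl))) (inj₂ (inj₁ (p , q))) = inj₂ (inj₁ (ε , q))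
  extend (fwd (inj₂ (refl , refl))) (inj₂ (inj₂ (p , q))) = inj₁ (q ⁻¹)
  extend (bwd (inj₂ (refl , refl))) (inj₁ p)              = inj₂ (inj₂ (ε , p ⁻¹))
  extend (bwd (inj₂ (refl , refl))) (inj₂ (inj₁ (p , q))) = inj₁ (q ⁻¹)
  extend (bwd (inj₂ (refl , refl))) (inj₂ (inj₂ (p , q))) = inj₂ (inj₂ (ε , q))

weaken-pair : ∀ {R : Rel A 0ℓ} {x y} → EqClosure R ⇒ EqClosure (R ∪ Pair x y)
weaken-pair = Eq.map inj₁

-- The class of `x` goes to `zero` and any other class to the class that contains it. By
-- `join-pair`, two distinct classes that merge include the class of `x`.
classCount-pair : ∀ {R : Rel A 0ℓ} {x y} → ClassCount R k → ClassCount (R ∪ Pair x y) l → k ≤ suc l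
classCount-pair {k = k} {l} {R = R} {x} {y} c c′ = Fin.injective⇒≤ {f = f} f-inj
  where
  module C = Classes c
  module C′ = Classes c′
  f : Fin k → Fin (suc l)
  f i with i Fin.≟ C.class x
  ... | yes _ = zero
  ... | no _  = suc (C′.class (C.rep i))
  f-inj : Injective _≡_ _≡_ f
  f-inj {i} {j} eq with i Fin.≟ C.class x | j Fin.≟ C.class x
  f-inj {i} {j} eq | yes p | yes q = trans p (sym q)
  f-inj {i} {j} eq | no ¬p | no ¬q with join-pair (C′.≡⇒~ (Fin.suc-injective eq))
  ... | inj₁ r              = trans (sym (C.class-rep i)) (trans (C.~⇒≡ r) (C.class-rep j))
  ... | inj₂ (inj₁ (r , _)) = contradiction (trans (sym (C.class-rep i)) (C.~⇒≡ r)) ¬p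
  ... | inj₂ (inj₂ (_ , r)) = contradiction (trans (sym (C.class-rep j)) (C.~⇒≡ r)) ¬q

merge : ∀ {R : Rel A 0ℓ} → ClassCount R k → ∀ x y → ∃ (ClassCount (R ∪ Pair x y))
merge {k = k} {R = R} c x y with ClassCount.class c x Fin.≟ ClassCount.class c y
... | yes eq = k , classCount-transport (single ∘ inj₁)
                     (λ { (inj₁ r) → single r ; (inj₂ (refl , refl)) → ≡⇒~ eq }) c
  where open Classes c
merge {k = ℕ.zero} c x y | no _ = contradiction (ClassCount.class c x) λ ()
merge {A = A} {k = suc m} {R = R} c x y | no x≢y = m , record
  { class = glue ∘ class
  ; onto  = λ t → let z , eq = onto (punchIn (class y) t) in
      z , trans (cong glue eq) (glue-punchIn t)
  ; exact = λ a b → mk⇔ (forth a b ∘ join-pair) (back a b)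
  }
  where
  open Classes c
  -- The number of the class of `y` is dropped, and that class takes over the number of the class of
  -- `x`.
  glue : Fin (suc m) → Fin m
  glue i with class y Fin.≟ i
  ... | yes _   = punchOut {i = class y} (x≢y ∘ sym)
  ... | no y≢i  = punchOut y≢i
  glue-y : glue (class y) ≡ punchOut {i = class y} (x≢y ∘ sym)
  glue-y with class y Fin.≟ class y
  ... | yes _  = refl
  ... | no y≢y = contradiction refl y≢y
  glue-≢ : ∀ {i} (y≢i : class y ≢ i) → glue i ≡ punchOut y≢i
  glue-≢ {i} y≢i with class y Fin.≟ i
  ... | yes y≡i = contradiction y≡i y≢i
  ... | no _    = punchOut-cong (class y) refl
  glue-punchIn : ∀ t → glue (punchIn (class y) t) ≡ t
  glue-punchIn t = trans (glue-≢ (punchInᵢ≢i (class y) t ∘ sym)) (punchOut-punchIn (class y))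
  glue-xy : glue (class x) ≡ glue (class y)
  glue-xy = trans (glue-≢ (x≢y ∘ sym)) (sym glue-y)
  forth : ∀ a b → _ → glue (class a) ≡ glue (class b)
  forth a b (inj₁ r)              = cong glue (~⇒≡ r)
  forth a b (inj₂ (inj₁ (p , q))) = trans (cong glue (~⇒≡ p)) (trans glue-xy (sym (cong glue (~⇒≡ q))))
  forth a b (inj₂ (inj₂ (p , q))) = trans (cong glue (~⇒≡ p)) (trans (sym glue-xy) (sym (cong glue (~⇒≡ q))))
  x~y : EqClosure (R ∪ Pair x y) x y
  x~y = single (inj₂ (refl , refl))
  ~x : ∀ {a} → class y ≡ class a → EqClosure (R ∪ Pair x y) a x
  ~x eq = weaken-pair (≡⇒~ (sym eq)) ◅◅ Eq.symmetric _ x~y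
  back : ∀ a b → glue (class a) ≡ glue (class b) → EqClosure (R ∪ Pair x y) a b
  back a b eq with class y Fin.≟ class a | class y Fin.≟ class b
  ... | yes p | yes q = weaken-pair (≡⇒~ (trans (sym p) q))
  ... | yes p | no q  = ~x p ◅◅ weaken-pair (≡⇒~ (punchOut-injective _ q eq))
  ... | no p  | yes q = weaken-pair (≡⇒~ (punchOut-injective p _ eq)) ◅◅ Eq.symmetric _ (~x q)
  ... | no p  | no q  = weaken-pair (≡⇒~ (punchOut-injective p q eq))

-- Supplies the class counts of submaps: their components arise from the vertices, and their regions
-- from the faces, by finitely many gluings.
merge-all : ∀ {R : Rel A 0ℓ} → ClassCount R k → (f g : Fin m → A) →
            ∃ (ClassCount (R ∪ (λ x y → ∃ λ i → Pair (f i) (g i) x y)))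
merge-all {m = ℕ.zero} c f g = _ , classCount-transport (single ∘ inj₁) (λ { (inj₁ r) → single r }) c
merge-all {m = suc m} c f g with merge-all c (f ∘ suc) (g ∘ suc)
... | _ , c′ = map₂ (classCount-transport
  (λ { (inj₁ (inj₁ r)) → single (inj₁ r) ; (inj₁ (inj₂ (i , r))) → single (inj₂ (suc i , r)) ; (inj₂ r) → single (inj₂ (zero , r)) })
  (λ { (inj₁ r) → single (inj₁ (inj₁ r)) ; (inj₂ (zero , r)) → single (inj₂ r) ; (inj₂ (suc i , r)) → single (inj₁ (inj₂ (i , r))) }))
  (merge c′ (f zero) (g zero))

-- Euler's formula for submaps

if-true : {A : Set} {b : Bool} {x y : A} → T b → (if b then x else y) ≡ x
if-true {b = true} _ = refl

if-false : {A : Set} {b : Bool} {x y : A} → ¬ T b → (if b then x else y) ≡ y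
if-false {b = true}  ¬p = contradiction tt ¬p
if-false {b = false} _  = refl

module CombinatorialMap
  {D : Set} {N : ℕ} (darts : Size D N) (rotation : D ↔ D)
  (rev : D → D) (rev-rev : ∀ d → rev (rev d) ≡ d) (rev-≢ : ∀ d → rev d ≢ d) where

  private
    variable
      S : D → Bool
      s V E F C c f : ℕ

  rot : D → D
  rot = Inverse.to rotation

  rot⁻¹ : D → D
  rot⁻¹ = Inverse.from rotation

  rot-rot⁻¹ : ∀ d → rot (rot⁻¹ d) ≡ d
  rot-rot⁻¹ = Inverse.strictlyInverseˡ rotation

  face : D → D
  face = rot ∘ rev

  rev-injective : Injective _≡_ _≡_ rev
  rev-injective {x} {y} eq = trans (sym (rev-rev x)) (trans (cong rev eq) (rev-rev y))

  rot⁻¹-injective : Injective _≡_ _≡_ rot⁻¹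
  rot⁻¹-injective = ↔-injective (↔-sym rotation)

  _≟_ : DecidableEquality D
  _≟_ = via-injection (↔⇒↣ darts) Fin._≟_

  dart : Fin N → D
  dart = Inverse.from darts

  dart-to : ∀ d → dart (Inverse.to darts d) ≡ d
  dart-to = Inverse.strictlyInverseʳ darts

  any-dart? : (P : D → Set) → (∀ d → Dec (P d)) → Dec (∃ P)
  any-dart? P P? with any? (P? ∘ dart)
  ... | yes (i , p) = yes (dart i , p)
  ... | no none = no λ (d , p) → none (Inverse.to darts d , subst P (sym (dart-to d)) p)

  -- For `S` closed under `rev`, the classes are the components of the spanning submap: a vertex
  -- that carries darts but none of `S` is a class by itself.
  Joined : (D → Bool) → Rel D 0ℓ
  Joined S = Steps rot ∪ (λ x y → T (S x) × rev x ≡ y)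

  -- The faces of the submap S are unions of faces of the whole map, merged
  -- across the edges that are not in S.
  Region : (D → Bool) → Rel D 0ℓ
  Region S = Steps face ∪ (λ x y → ¬ T (S x) × rev x ≡ y)

  RevClosed : (D → Bool) → Set
  RevClosed S = ∀ d → S (rev d) ≡ S d

  _⊕_ : (D → Bool) → D → D → Bool
  (S ⊕ d) x = S x ∨ isYes (x ≟ d) ∨ isYes (x ≟ rev d)

  ⊕-elim : ∀ {S d x} → T ((S ⊕ d) x) → T (S x) ⊎ x ≡ d ⊎ x ≡ rev d
  ⊕-elim {S} {d} {x} p with Equivalence.to (T-∨ {S x}) p
  ... | inj₁ q = inj₁ q
  ... | inj₂ q = inj₂ (Sum.map toWitness toWitness (Equivalence.to (T-∨ {isYes (x ≟ d)}) q))

  ⊕-old : ∀ {S d x} → T (S x) → T ((S ⊕ d) x)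
  ⊕-old {S} {d} {x} p = Equivalence.from (T-∨ {S x}) (inj₁ p)

  ⊕-new : ∀ S d → T ((S ⊕ d) d)
  ⊕-new S d = Equivalence.from (T-∨ {S d}) (inj₂ (Equivalence.from (T-∨ {isYes (d ≟ d)}) (inj₁ (fromWitness refl))))

  ⊕-new-rev : ∀ S d → T ((S ⊕ d) (rev d))
  ⊕-new-rev S d = Equivalence.from (T-∨ {S (rev d)})
    (inj₂ (Equivalence.from (T-∨ {isYes (rev d ≟ d)}) (inj₂ (fromWitness refl))))

  ⊕-closed : ∀ {S} → RevClosed S → ∀ d → RevClosed (S ⊕ d)
  ⊕-closed {S} S-rev d x = T-≡ (flip-⊕ x) λ p → flip-⊕ (rev x) (subst (T ∘ (S ⊕ d)) (sym (rev-rev x)) p)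
    where
    T-≡ : ∀ {a b} → (T b → T a) → (T a → T b) → b ≡ a
    T-≡ {true}  {true}  _ _ = refl
    T-≡ {false} {false} _ _ = refl
    T-≡ {true}  {false} _ g = contradiction (g tt) id
    T-≡ {false} {true}  g _ = contradiction (g tt) id
    flip-⊕ : ∀ x → T ((S ⊕ d) (rev x)) → T ((S ⊕ d) x)
    flip-⊕ x p with ⊕-elim {S} {d} {rev x} p
    ... | inj₁ q           = ⊕-old {S} {d} (subst T (S-rev x) q)
    ... | inj₂ (inj₁ eq)   = subst (T ∘ (S ⊕ d)) (trans (cong rev (sym eq)) (rev-rev x)) (⊕-new-rev S d)
    ... | inj₂ (inj₂ eq)   = subst (T ∘ (S ⊕ d)) (sym (rev-injective eq)) (⊕-new S d)

  -- Let X be the component of d in S and K the region of d in S ⊕ d. As face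
  -- permutes K, as many darts of K start in X as end in X. Apart from d and
  -- rev d, the darts of K entering or leaving X are not in S ⊕ d, so reversing
  -- them stays in K; hence if K lacked rev d, the darts of K starting in X
  -- would inject into themselves missing d.
  bridge : ∀ {d} (jc : ClassCount (Joined S) c) (rc : ClassCount (Region (S ⊕ d)) f) →
           ClassCount.class jc d ≢ ClassCount.class jc (rev d) →
           ClassCount.class rc d ≡ ClassCount.class rc (rev d)
  bridge {S} {d = d} jc rc d≁ = decidable-stable (R.class d Fin.≟ R.class (rev d)) λ K∌rev →
    ℕ.1+n≰n (size-mono (size-⊎ size-⊤ size-K) size-K
      (λ { (inj₁ tt) → start ; (inj₂ a) → turn K∌rev a })
      λ { {inj₁ tt} {inj₁ tt} _ → refl
        ; {inj₁ tt} {inj₂ a} eq → contradiction (sym (cong proj₁ eq)) (turn-≢ K∌rev a)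
        ; {inj₂ a} {inj₁ tt} eq → contradiction (cong proj₁ eq) (turn-≢ K∌rev a)
        ; {inj₂ a} {inj₂ b} eq → cong inj₂ (turn-injective K∌rev a b (cong proj₁ eq)) })
    where
    module J = Classes jc
    module R = Classes rc
    InX InK : D → Set
    InX a = J.class a ≡ J.class d
    InK a = R.class a ≡ R.class d
    inner? : ∀ a → Dec (InX a × InK a)
    inner? a = (J.class a Fin.≟ J.class d) ×-dec (R.class a Fin.≟ R.class d)
    Inner : Set
    Inner = Σ D (T ∘ isYes ∘ inner?)
    size-K : Size Inner _
    size-K = proj₂ (size-subtype darts (isYes ∘ inner?))
    start : Inner
    start = d , fromWitness (refl , refl)
    -- The inverse of `face`: the dart before `a` on its face.
    back : D → D
    back a = rev (rot⁻¹ a)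
    back-K : ∀ {a} → InK a → InK (back a)
    back-K {a} p = trans (R.step (inj₁ (trans (cong rot (rev-rev _)) (rot-rot⁻¹ a)))) p
    back-X : ∀ {a} → InX a → InX (rev (back a))
    back-X {a} p = trans (J.step (inj₁ (trans (cong rot (rev-rev _)) (rot-rot⁻¹ a)))) p
    back-injective : Injective _≡_ _≡_ back
    back-injective = rot⁻¹-injective ∘ rev-injective
    module _ (K∌rev : R.class d ≢ R.class (rev d)) where
      outside : ∀ {b} → InX (rev b) → InK b → ¬ InX b → ¬ T ((S ⊕ d) b)
      outside {b} x k ¬x p with ⊕-elim {S} p
      ... | inj₁ q           = ¬x (trans (J.step (inj₂ (q , refl))) x)
      ... | inj₂ (inj₁ refl) = ¬x refl
      ... | inj₂ (inj₂ refl) = K∌rev (sym k)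
      -- If the step back leaves X, its edge is outside `S ⊕ d`, so the reversed dart stays in K and
      -- starts in X.
      turn : Inner → Inner
      turn (a , p) with toWitness p | J.class (back a) Fin.≟ J.class d
      ... | x , k | yes x′ = back a , fromWitness (x′ , back-K k)
      ... | x , k | no ¬x′ = rev (back a) ,
        fromWitness (back-X x , trans (sym (R.step (inj₂ (outside (back-X x) (back-K k) ¬x′ , refl)))) (back-K k))
      turn-≢ : ∀ a → proj₁ (turn a) ≢ d
      turn-≢ (a , p) eq with toWitness p | J.class (back a) Fin.≟ J.class d
      ... | x , k | yes x′ = d≁ (sym (trans (cong (J.class ∘ rev) (sym eq)) (back-X x)))
      ... | x , k | no ¬x′ = K∌rev (sym (trans (cong R.class (trans (cong rev (sym eq)) (rev-rev _))) (back-K k)))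
      turn-injective : ∀ a b → proj₁ (turn a) ≡ proj₁ (turn b) → a ≡ b
      turn-injective (a , p) (b , q) eq
        with toWitness p | J.class (back a) Fin.≟ J.class d | toWitness q | J.class (back b) Fin.≟ J.class d
      ... | _ | yes _ | _ | yes _ = Σ-T-≡ (back-injective eq)
      ... | _ | no _  | _ | no _  = Σ-T-≡ (back-injective (rev-injective eq))
      ... | x , _ | yes _ | _ | no ¬y = contradiction (trans (cong J.class (trans (sym (rev-rev _)) (cong rev (sym eq)))) (back-X x)) ¬y
      ... | _ | no ¬x | y , _ | yes _ = contradiction (trans (cong J.class (trans (sym (rev-rev _)) (cong rev eq))) (back-X y)) ¬x

  edge-pair : ∀ {x y} → EqClosure (Steps rev) x y → y ≡ x ⊎ y ≡ rev x
  edge-pair ε = inj₁ refl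
  edge-pair {x} (fwd refl ◅ w) with edge-pair w
  ... | inj₁ eq = inj₂ eq
  ... | inj₂ eq = inj₁ (trans eq (rev-rev x))
  edge-pair (bwd refl ◅ w) with edge-pair w
  ... | inj₁ eq = inj₂ (trans eq (sym (rev-rev _)))
  ... | inj₂ eq = inj₁ eq

  -- A dart is determined by its edge and by whether it is the chosen representative of that edge.
  darts≤ : ClassCount (Steps rev) E → N ≤ 2 * E
  darts≤ ec = size-mono darts (size-× (↔-sym 2↔Bool) (↔-id _))
    (λ d → isYes (rep (class d) ≟ d) , class d)
    λ {x} {y} eq → same x y (,-injectiveʳ eq) (,-injectiveˡ eq)
    where
    open Classes ec
    other : ∀ x → rep (class x) ≢ x → x ≡ rev (rep (class x))
    other x x≢ with edge-pair (rep~ x)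
    ... | inj₁ eq = contradiction (sym eq) x≢
    ... | inj₂ eq = eq
    same : ∀ x y → class x ≡ class y → isYes (rep (class x) ≟ x) ≡ isYes (rep (class y) ≟ y) → x ≡ y
    same x y eq b with rep (class x) ≟ x | rep (class y) ≟ y
    ... | yes p | yes q = trans (sym p) (trans (cong rep eq) q)
    ... | no p  | no q  = trans (other x p) (trans (cong (rev ∘ rep) eq) (sym (other y q)))

  module _ (vc : ClassCount (Steps rot) V) (ec : ClassCount (Steps rev) E) (fc : ClassCount (Steps face) F)
           (cc : ClassCount (Steps rot ∪ Steps rev) C) (euler : V + F ≡ E + 2 * C) where

    joined-classes : ∀ S → ∃ (ClassCount (Joined S))
    joined-classes S = map₂ (classCount-transport forth back) (merge-all vc dart other)
      where
      -- Every dart needs a partner; pairing a dart outside `S` with itself glues nothing.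
      other : Fin N → D
      other i = if S (dart i) then rev (dart i) else dart i
      forth : Steps rot ∪ (λ x y → ∃ λ i → Pair (dart i) (other i) x y) ⇒ EqClosure (Joined S)
      forth (inj₁ r) = single (inj₁ r)
      forth (inj₂ (i , refl , refl)) with S (dart i) in eq
      ... | true  = single (inj₂ (subst T (sym eq) tt , refl))
      ... | false = ε
      back : Joined S ⇒ EqClosure (Steps rot ∪ (λ x y → ∃ λ i → Pair (dart i) (other i) x y))
      back (inj₁ r) = single (inj₁ r)
      back {x} (inj₂ (p , refl)) = single (inj₂ (Inverse.to darts x , dart-to x , eq))
        where
        eq : other (Inverse.to darts x) ≡ rev x
        eq rewrite dart-to x = if-true p

    region-classes : ∀ S → ∃ (ClassCount (Region S))
    region-classes S = map₂ (classCount-transport forth back) (merge-all fc dart other)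
      where
      other : Fin N → D
      other i = if S (dart i) then dart i else rev (dart i)
      forth : Steps face ∪ (λ x y → ∃ λ i → Pair (dart i) (other i) x y) ⇒ EqClosure (Region S)
      forth (inj₁ r) = single (inj₁ r)
      forth (inj₂ (i , refl , refl)) with S (dart i) in eq
      ... | true  = ε
      ... | false = single (inj₂ (subst T eq , refl))
      back : Region S ⇒ EqClosure (Steps face ∪ (λ x y → ∃ λ i → Pair (dart i) (other i) x y))
      back (inj₁ r) = single (inj₁ r)
      back {x} (inj₂ (p , refl)) = single (inj₂ (Inverse.to darts x , dart-to x , eq))
        where
        eq : other (Inverse.to darts x) ≡ rev x
        eq rewrite dart-to x = if-false p

    private
      -- The inequality is doubled because `s` counts darts, two for each edge of the submap.
      EulerBound : ℕ → ℕ → ℕ → Set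
      EulerBound s c f = s + 2 * (c + C) ≤ 2 * (V + f)

    -- With all darts present there are no more components than in the map, no fewer regions than
    -- faces, and at most two darts for each edge.
    euler-all : (∀ d → T (S d)) → Size (Σ D (T ∘ S)) s → ClassCount (Joined S) c → ClassCount (Region S) f →
                EulerBound s c f
    euler-all {S} {s} {c} {f} all ss jc rc = begin
      s + 2 * (c + C)     ≤⟨ ℕ.+-mono-≤ s≤ (ℕ.*-monoʳ-≤ 2 (ℕ.+-monoˡ-≤ C c≤)) ⟩
      2 * E + 2 * (C + C) ≡⟨ solve 2 (λ e c → con 2 :* e :+ con 2 :* (c :+ c) := con 2 :* (e :+ con 2 :* c)) refl E C ⟩
      2 * (E + 2 * C)     ≡⟨ cong (2 *_) euler ⟨
      2 * (V + F)         ≤⟨ ℕ.*-monoʳ-≤ 2 (ℕ.+-monoʳ-≤ V F≤) ⟩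
      2 * (V + f)         ∎
      where
      open ℕ.≤-Reasoning
      open +-*-Solver
      s≤ : s ≤ 2 * E
      s≤ = ℕ.≤-trans (size-mono ss darts proj₁ Σ-T-≡) (darts≤ ec)
      c≤ : c ≤ C
      c≤ = classCount-anti (λ { (inj₁ r) → single (inj₁ r) ; (inj₂ r) → single (inj₂ (all _ , r)) }) cc jc
      F≤ : F ≤ f
      F≤ = classCount-anti (λ { (inj₁ r) → single r ; (inj₂ (¬p , _)) → contradiction (all _) ¬p }) rc fc

    euler-step : ∀ {d s⁺ c⁺ f⁺} → RevClosed S → ¬ T (S d) →
                 2 + s ≤ s⁺ →
                 ClassCount (Joined S) c → ClassCount (Region S) f →
                 ClassCount (Joined (S ⊕ d)) c⁺ → ClassCount (Region (S ⊕ d)) f⁺ →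
                 EulerBound s⁺ c⁺ f⁺ → EulerBound s c f
    euler-step {S} {s} {c} {f} {d} {s⁺} {c⁺} {f⁺} S-rev d∉ s≤ jc rc jc⁺ rc⁺ bound
      with ClassCount.class jc d Fin.≟ ClassCount.class jc (rev d)
    ... | yes d~ = ℕ.+-cancelˡ-≤ 2 _ _ (begin
      2 + (s + 2 * (c + C))  ≤⟨ ℕ.+-mono-≤ s≤ (ℕ.*-monoʳ-≤ 2 (ℕ.+-monoˡ-≤ C c≤)) ⟩
      s⁺ + 2 * (c⁺ + C)      ≤⟨ bound ⟩
      2 * (V + f⁺)           ≤⟨ ℕ.*-monoʳ-≤ 2 (ℕ.+-monoʳ-≤ V f⁺≤) ⟩
      2 * (V + suc f)        ≡⟨ solve 2 (λ v f → con 2 :* (v :+ (con 1 :+ f)) := con 2 :+ con 2 :* (v :+ f)) refl V f ⟩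
      2 + 2 * (V + f)        ∎)
      where
      open ℕ.≤-Reasoning
      open +-*-Solver
      c≤ : c ≤ c⁺
      c≤ = classCount-anti joined jc⁺ jc
        where
        d~rev : EqClosure (Joined S) d (rev d)
        d~rev = Classes.≡⇒~ jc d~
        joined : Joined (S ⊕ d) ⇒ EqClosure (Joined S)
        joined (inj₁ r) = single (inj₁ r)
        joined {x} (inj₂ (p , refl)) with ⊕-elim {S} {d} {x} p
        ... | inj₁ q           = single (inj₂ (q , refl))
        ... | inj₂ (inj₁ refl) = d~rev
        ... | inj₂ (inj₂ refl) = subst (EqClosure (Joined S) (rev d)) (sym (rev-rev d)) (Eq.symmetric _ d~rev)
      f⁺≤ : f⁺ ≤ suc f
      f⁺≤ = classCount-pair rc⁺ (classCount-transport region region′ rc)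
        where
        region : Region S ⇒ EqClosure (Region (S ⊕ d) ∪ Pair d (rev d))
        region (inj₁ r) = single (inj₁ (inj₁ r))
        region {x} (inj₂ (¬p , refl)) with T? ((S ⊕ d) x)
        ... | no ¬p⁺ = single (inj₁ (inj₂ (¬p⁺ , refl)))
        ... | yes p⁺ with ⊕-elim {S} {d} {x} p⁺
        ...   | inj₁ p           = contradiction p ¬p
        ...   | inj₂ (inj₁ refl) = single (inj₂ (refl , refl))
        ...   | inj₂ (inj₂ refl) = bwd (inj₂ (sym (rev-rev d) , refl)) ◅ ε
        region′ : Region (S ⊕ d) ∪ Pair d (rev d) ⇒ EqClosure (Region S)
        region′ (inj₁ (inj₁ r))          = single (inj₁ r)
        region′ (inj₁ (inj₂ (¬p , r)))   = single (inj₂ (¬p ∘ ⊕-old {S} {d} , r))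
        region′ (inj₂ (refl , refl))     = single (inj₂ (d∉ , refl))
    ... | no d≁ = begin
      s + 2 * (c + C)        ≤⟨ ℕ.+-monoʳ-≤ s (ℕ.*-monoʳ-≤ 2 (ℕ.+-monoˡ-≤ C c≤)) ⟩
      s + 2 * (suc c⁺ + C)   ≡⟨ solve 3 (λ s c d → s :+ con 2 :* (con 1 :+ c :+ d) := con 2 :+ s :+ con 2 :* (c :+ d)) refl s c⁺ C ⟩
      2 + s + 2 * (c⁺ + C)   ≤⟨ ℕ.+-monoˡ-≤ _ s≤ ⟩
      s⁺ + 2 * (c⁺ + C)      ≤⟨ bound ⟩
      2 * (V + f⁺)           ≤⟨ ℕ.*-monoʳ-≤ 2 (ℕ.+-monoʳ-≤ V f⁺≤) ⟩
      2 * (V + f)            ∎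
      where
      open ℕ.≤-Reasoning
      open +-*-Solver
      c≤ : c ≤ suc c⁺
      c≤ = classCount-pair jc (classCount-transport joined joined′ jc⁺)
        where
        joined : Joined (S ⊕ d) ⇒ EqClosure (Joined S ∪ Pair d (rev d))
        joined (inj₁ r) = single (inj₁ (inj₁ r))
        joined {x} (inj₂ (p , refl)) with ⊕-elim {S} {d} {x} p
        ... | inj₁ q           = single (inj₁ (inj₂ (q , refl)))
        ... | inj₂ (inj₁ refl) = single (inj₂ (refl , refl))
        ... | inj₂ (inj₂ refl) = bwd (inj₂ (sym (rev-rev d) , refl)) ◅ ε
        joined′ : Joined S ∪ Pair d (rev d) ⇒ EqClosure (Joined (S ⊕ d))
        joined′ (inj₁ (inj₁ r))       = single (inj₁ r)
        joined′ (inj₁ (inj₂ (p , r))) = single (inj₂ (⊕-old {S} {d} p , r))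
        joined′ (inj₂ (refl , refl))  = single (inj₂ (⊕-new S d , refl))
      f⁺≤ : f⁺ ≤ f
      f⁺≤ = classCount-anti region rc rc⁺
        where
        d~rev : EqClosure (Region (S ⊕ d)) d (rev d)
        d~rev = Classes.≡⇒~ rc⁺ (bridge jc rc⁺ d≁)
        region : Region S ⇒ EqClosure (Region (S ⊕ d))
        region (inj₁ r) = single (inj₁ r)
        region {x} (inj₂ (¬p , refl)) with T? ((S ⊕ d) x)
        ... | no ¬p⁺ = single (inj₂ (¬p⁺ , refl))
        ... | yes p⁺ with ⊕-elim {S} {d} {x} p⁺
        ...   | inj₁ p           = contradiction p ¬p
        ...   | inj₂ (inj₁ refl) = d~rev
        ...   | inj₂ (inj₂ refl) = subst (EqClosure (Region (S ⊕ d)) (rev d)) (sym (rev-rev d)) (Eq.symmetric _ d~rev)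

    -- Induction on a bound `m` for the number of darts outside `S`: a missing edge is added, and
    -- `euler-step` carries the bound back from the larger submap.
    euler-submap : ∀ m → RevClosed S → N ≤ s + m → Size (Σ D (T ∘ S)) s →
                   ClassCount (Joined S) c → ClassCount (Region S) f → EulerBound s c f
    euler-submap {S} {s} m S-rev N≤ ss jc rc with any-dart? (¬_ ∘ T ∘ S) (λ d → ¬? (T? (S d)))
    ... | no none = euler-all (λ d → decidable-stable (T? (S d)) (λ d∉ → none (d , d∉))) ss jc rc
    euler-submap {S} {s} ℕ.zero S-rev N≤ ss jc rc | yes (d , d∉) = contradiction s<N (ℕ.≤⇒≯ (subst (N ≤_) (ℕ.+-identityʳ s) N≤))
      where
      s<N : suc s ≤ N
      s<N = size-mono (size-⊎ size-⊤ ss) darts [ (λ _ → d) , proj₁ ]′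
        λ { {inj₁ tt} {inj₁ tt} _ → refl
          ; {inj₁ tt} {inj₂ (x , p)} refl → contradiction p d∉
          ; {inj₂ (x , p)} {inj₁ tt} refl → contradiction p d∉
          ; {inj₂ _} {inj₂ _} eq → cong inj₂ (Σ-T-≡ eq) }
    euler-submap {S} {s} (suc m) S-rev N≤ ss jc rc | yes (d , d∉)
      with s⁺ , ss⁺ ← size-subtype darts (S ⊕ d) | _ , jc⁺ ← joined-classes (S ⊕ d) | _ , rc⁺ ← region-classes (S ⊕ d)
      = euler-step S-rev d∉ s≤ jc rc jc⁺ rc⁺
          (euler-submap m (⊕-closed S-rev d) (ℕ.≤-trans N≤ s+m≤) ss⁺ jc⁺ rc⁺)
      where
      rev∉ : ¬ T (S (rev d))
      rev∉ = d∉ ∘ subst T (S-rev d)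
      s≤ : 2 + s ≤ s⁺
      s≤ = size-mono (size-⊎ (size-⊎ size-⊤ size-⊤) ss) ss⁺
        (λ { (inj₁ (inj₁ tt)) → d , ⊕-new S d
           ; (inj₁ (inj₂ tt)) → rev d , ⊕-new-rev S d
           ; (inj₂ (x , p))   → x , ⊕-old {S} p })
        λ { {inj₁ (inj₁ tt)} {inj₁ (inj₁ tt)} _ → refl
          ; {inj₁ (inj₂ tt)} {inj₁ (inj₂ tt)} _ → refl
          ; {inj₁ (inj₁ tt)} {inj₁ (inj₂ tt)} eq → contradiction (sym (cong proj₁ eq)) (rev-≢ d)
          ; {inj₁ (inj₂ tt)} {inj₁ (inj₁ tt)} eq → contradiction (cong proj₁ eq) (rev-≢ d)
          ; {inj₁ (inj₁ tt)} {inj₂ (x , p)} eq → contradiction (subst (T ∘ S) (sym (cong proj₁ eq)) p) d∉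
          ; {inj₁ (inj₂ tt)} {inj₂ (x , p)} eq → contradiction (subst (T ∘ S) (sym (cong proj₁ eq)) p) rev∉
          ; {inj₂ (x , p)} {inj₁ (inj₁ tt)} eq → contradiction (subst (T ∘ S) (cong proj₁ eq) p) d∉
          ; {inj₂ (x , p)} {inj₁ (inj₂ tt)} eq → contradiction (subst (T ∘ S) (cong proj₁ eq) p) rev∉
          ; {inj₂ _} {inj₂ _} eq → cong inj₂ (Σ-T-≡ (cong proj₁ eq)) }
      s+m≤ : s + suc m ≤ s⁺ + m
      s+m≤ = ℕ.≤-trans (ℕ.≤-reflexive (ℕ.+-suc s m)) (ℕ.+-monoˡ-≤ m (ℕ.≤-trans (ℕ.n≤1+n _) s≤))

-- Colourings

-- nothing is the matching colour, just s are the strong colours.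
Color : Set
Color = Maybe (Fin 5)

-- A palette also contains the matching colour, which is not recorded.
record Palette : Set where
  constructor palette
  field
    p q : Fin 5
    p≢q : p ≢ q

infix 4 _∈ₚ_ _∈⁰_

_∈ₚ_ : Fin 5 → Palette → Set
s ∈ₚ P = s ≡ Palette.p P ⊎ s ≡ Palette.q P

data _∈⁰_ : Color → Palette → Set where
  zero : ∀ {P} → nothing ∈⁰ P
  pick : ∀ {P s} → s ∈ₚ P → just s ∈⁰ P

-- Across an edge of the matching colour, where `c` is `nothing`, the strong colours of the two
-- palettes are disjoint.
Compatible : Palette → Palette → Color → Set
Compatible P Q c = ∀ {s} → s ∈ₚ P → s ∈ₚ Q → just s ≡ c

-- The edges at v take their colours from the palette of v, whether or not v has
-- three edges, so compatibility across an edge uv keeps equal strong colours at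
-- distance three.
record Coloring (R : Rel (Fin n) 0ℓ) : Set where
  field
    pal        : Fin n → Palette
    κ          : Fin n → Fin n → Color
    κ-sym      : ∀ {u v} → R u v → κ u v ≡ κ v u
    κ-pal      : ∀ {u v} → R u v → κ u v ∈⁰ pal u
    proper     : ∀ {u v w} → R u v → R u w → κ u v ≡ κ u w → v ≡ w
    compatible : ∀ {u v} → R u v → Compatible (pal u) (pal v) (κ u v)

open Coloring

Free : {R : Rel (Fin n) 0ℓ} → Coloring R → Fin n → Color → Set
Free {R = R} X v c = ∀ {y} → R v y → κ X v y ≢ c

Isolated : Rel (Fin n) 0ℓ → Fin n → Set
Isolated R v = ∀ {y} → ¬ R v y

-- The inclusion runs from the edges of `Y` at `v` to those of `X`; this direction lets freeness of
-- a colour and isolation pass from `X` to `Y`.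
record Same {R R′ : Rel (Fin n) 0ℓ} (X : Coloring R) (Y : Coloring R′) (v : Fin n) : Set where
  constructor same
  field
    pal≡ : pal Y v ≡ pal X v
    nbr  : ∀ {y} → R′ v y → R v y × κ Y v y ≡ κ X v y

open Same

free-same : {R R′ : Rel (Fin n) 0ℓ} {X : Coloring R} {Y : Coloring R′} {v : Fin n} {c : Color} → Same X Y v → Free X v c → Free Y v c
free-same s fr r eq = let r′ , κ≡ = nbr s r in fr r′ (trans (sym κ≡) eq)

isolated-same : {R R′ : Rel (Fin n) 0ℓ} {X : Coloring R} {Y : Coloring R′} {v : Fin n} → Same X Y v → Isolated R v → Isolated R′ v
isolated-same s iso = iso ∘ proj₁ ∘ nbr s

same-trans : {R R′ R″ : Rel (Fin n) 0ℓ} {X : Coloring R} {Y : Coloring R′} {Z : Coloring R″} {v : Fin n} →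
             Same X Y v → Same Y Z v → Same X Z v
same-trans s t = same (trans (pal≡ t) (pal≡ s)) λ r → let r′ , e′ = nbr t r; r″ , e″ = nbr s r′ in r″ , trans e′ e″

restrict : {R R′ : Rel (Fin n) 0ℓ} → (∀ {x y} → R x y → R′ x y) → Coloring R′ → Coloring R
restrict R⊆ X = record
  { pal = pal X ; κ = κ X ; κ-sym = κ-sym X ∘ R⊆ ; κ-pal = κ-pal X ∘ R⊆
  ; proper = λ r r′ → proper X (R⊆ r) (R⊆ r′) ; compatible = compatible X ∘ R⊆ }

-- Repainting an isolated vertex and adding an edge

module _ {R : Rel (Fin n) 0ℓ} (R-sym : Symmetric R) (X : Coloring R) {v : Fin n} (iso : Isolated R v) (P : Palette) where

  private
    pal′ : Fin n → Palette
    pal′ w with w Fin.≟ v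
    ... | yes _ = P
    ... | no _  = pal X w

    pal′-old : ∀ {w} → w ≢ v → pal′ w ≡ pal X w
    pal′-old {w} w≢v with w Fin.≟ v
    ... | yes w≡v = contradiction w≡v w≢v
    ... | no _    = refl

    pal′-new : pal′ v ≡ P
    pal′-new with v Fin.≟ v
    ... | yes _  = refl
    ... | no v≢v = contradiction refl v≢v

    tail≢ : ∀ {u w} → R u w → u ≢ v
    tail≢ r refl = iso r

  opaque

    -- No edge meets an isolated vertex, so no condition on a colouring sees its palette.
    repaint : Coloring R
    repaint = record
      { pal = pal′ ; κ = κ X ; κ-sym = κ-sym X
      ; κ-pal = λ r → subst (_ ∈⁰_) (sym (pal′-old (tail≢ r))) (κ-pal X r)
      ; proper = proper X
      ; compatible = λ r s t → compatible X r (subst (_ ∈ₚ_) (pal′-old (tail≢ r)) s) (subst (_ ∈ₚ_) (pal′-old (tail≢ (R-sym r))) t) }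

    repaint-pal : pal repaint v ≡ P
    repaint-pal = pal′-new

    repaint-same : ∀ {w} → w ≢ v → Same X repaint w
    repaint-same w≢v = same (pal′-old w≢v) λ r → r , refl

Joins : Fin n → Fin n → Rel (Fin n) 0ℓ
Joins u v x y = (x ≡ u × y ≡ v) ⊎ (x ≡ v × y ≡ u)

data _+[_-_] (R : Rel (Fin n) 0ℓ) (u v x y : Fin n) : Set where
  old : R x y → (R +[ u - v ]) x y
  new : Joins u v x y → (R +[ u - v ]) x y

joins-sym : {u v : Fin n} → Symmetric (Joins u v)
joins-sym (inj₁ (p , q)) = inj₂ (q , p)
joins-sym (inj₂ (p , q)) = inj₁ (q , p)

+-symmetric : {R : Rel (Fin n) 0ℓ} {u v : Fin n} → Symmetric R → Symmetric (R +[ u - v ])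
+-symmetric R-sym (old r) = old (R-sym r)
+-symmetric R-sym (new j) = new (joins-sym j)

module _ {R : Rel (Fin n) 0ℓ} (R-sym : Symmetric R) (X : Coloring R) {u v : Fin n} {c : Color}
         (u≢v : u ≢ v) (c∈u : c ∈⁰ pal X u) (c∈v : c ∈⁰ pal X v) (comp : Compatible (pal X u) (pal X v) c)
         (free-u : Free X u c) (free-v : Free X v c) where

  private
    joins? : ∀ x y → Dec (Joins u v x y)
    joins? x y = ((x Fin.≟ u) ×-dec (y Fin.≟ v)) ⊎-dec ((x Fin.≟ v) ×-dec (y Fin.≟ u))

    κ′ : Fin n → Fin n → Color
    κ′ x y with joins? x y
    ... | yes _ = c
    ... | no _  = κ X x y

    κ′-new : ∀ {x y} → Joins u v x y → κ′ x y ≡ c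
    κ′-new {x} {y} j with joins? x y
    ... | yes _ = refl
    ... | no ¬j = contradiction j ¬j

    free-end : ∀ {x y} → Joins u v x y → Free X x c
    free-end (inj₁ (refl , _)) = free-u
    free-end (inj₂ (refl , _)) = free-v

    κ′-old : ∀ {x y} → ¬ Joins u v x y → κ′ x y ≡ κ X x y
    κ′-old {x} {y} ¬j with joins? x y
    ... | yes j = contradiction j ¬j
    ... | no _ = refl

    joins-functional : ∀ {x y z} → Joins u v x y → Joins u v x z → y ≡ z
    joins-functional (inj₁ (_ , refl)) (inj₁ (_ , refl)) = refl
    joins-functional (inj₂ (_ , refl)) (inj₂ (_ , refl)) = refl
    joins-functional (inj₁ (refl , _)) (inj₂ (eq , _))   = contradiction eq u≢v
    joins-functional (inj₂ (refl , _)) (inj₁ (eq , _))   = contradiction (sym eq) u≢v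

    -- An edge of `R` that already joins `u` and `v` counts as added, in agreement with `κ′`, which
    -- gives it the colour `c`.
    data View (x y : Fin n) : Set where
      kept  : R x y → ¬ Joins u v x y → View x y
      added : Joins u v x y → View x y

    view : ∀ {x y} → (R +[ u - v ]) x y → View x y
    view (new j) = added j
    view {x} {y} (old r) with joins? x y
    ... | yes j = added j
    ... | no ¬j = kept r ¬j

    sym′ : ∀ {x y} → View x y → κ′ x y ≡ κ′ y x
    sym′ (added j)   = trans (κ′-new j) (sym (κ′-new (joins-sym j)))
    sym′ (kept r ¬j) = trans (κ′-old ¬j) (trans (κ-sym X r) (sym (κ′-old (¬j ∘ joins-sym))))

    pal′ : ∀ {x y} → View x y → κ′ x y ∈⁰ pal X x
    pal′ (added j@(inj₁ (refl , _))) = subst (_∈⁰ _) (sym (κ′-new j)) c∈u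
    pal′ (added j@(inj₂ (refl , _))) = subst (_∈⁰ _) (sym (κ′-new j)) c∈v
    pal′ (kept r ¬j) = subst (_∈⁰ _) (sym (κ′-old ¬j)) (κ-pal X r)

    proper′ : ∀ {x y z} → View x y → View x z → κ′ x y ≡ κ′ x z → y ≡ z
    proper′ (added j)  (added k)   _  = joins-functional j k
    proper′ (kept r ¬j) (kept s ¬k) eq = proper X r s (trans (sym (κ′-old ¬j)) (trans eq (κ′-old ¬k)))
    proper′ (added j)  (kept s ¬k) eq = contradiction (trans (sym (κ′-old ¬k)) (trans (sym eq) (κ′-new j))) (free-end j s)
    proper′ (kept r ¬j) (added k)  eq = contradiction (trans (sym (κ′-old ¬j)) (trans eq (κ′-new k))) (free-end k r)

    compatible′ : ∀ {x y} → View x y → Compatible (pal X x) (pal X y) (κ′ x y)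
    compatible′ (added j@(inj₁ (refl , refl))) s t = trans (comp s t) (sym (κ′-new j))
    compatible′ (added j@(inj₂ (refl , refl))) s t = trans (comp t s) (sym (κ′-new j))
    compatible′ (kept r ¬j) s t = trans (compatible X r s t) (sym (κ′-old ¬j))

  join : Coloring (R +[ u - v ])
  join = record
    { pal = pal X ; κ = κ′ ; κ-sym = sym′ ∘ view ; κ-pal = pal′ ∘ view
    ; proper = λ r s → proper′ (view r) (view s) ; compatible = compatible′ ∘ view }

  join-same : ∀ {w} → w ≢ u → w ≢ v → Same X join w
  join-same {w} w≢u w≢v = same refl λ r → elsewhere (view r)
    where
    elsewhere : ∀ {y} → View w y → R w y × κ′ w y ≡ κ X w y
    elsewhere (kept r ¬j)              = r , κ′-old ¬j
    elsewhere (added (inj₁ (eq , _))) = contradiction eq w≢u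
    elsewhere (added (inj₂ (eq , _))) = contradiction eq w≢v

  join-free : ∀ {w d} → d ≢ c → Free X w d → Free join w d
  join-free {w} {d} d≢c fr r = elsewhere (view r)
    where
    elsewhere : ∀ {y} → View w y → κ′ w y ≢ d
    elsewhere (kept r ¬j) eq = fr r (trans (sym (κ′-old ¬j)) eq)
    elsewhere (added j)   eq = d≢c (trans (sym eq) (κ′-new j))

infixl 5 _+[_-_]

record Attached {R : Rel (Fin n) 0ℓ} (X : Coloring R) (u v : Fin n) (c : Color) (P : Palette) : Set where
  field
    Y      : Coloring (R +[ u - v ])
    pal-v  : pal Y v ≡ P
    free-v : ∀ {d} → d ≢ c → Free Y v d
    same-w : ∀ {w} → w ≢ u → w ≢ v → Same X Y w

opaque

  -- The palette of `v` is set while `v` is isolated and the edge is joined afterwards, so `P` is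
  -- constrained by the palette of `u` alone.
  attach : {R : Rel (Fin n) 0ℓ} → Symmetric R → (X : Coloring R) {u v : Fin n} {c : Color} {P : Palette} → u ≢ v → Isolated R v →
           c ∈⁰ pal X u → c ∈⁰ P → Compatible (pal X u) P c → Free X u c → Attached X u v c P
  attach {R = R} R-sym X {u} {v} {c} {P} u≢v iso c∈u c∈P comp fr = record
    { Y = join R-sym Z u≢v c∈u′ c∈P′ comp′ fr′ iso′
    ; pal-v = repaint-pal R-sym X iso P
    ; free-v = λ d≢c → join-free R-sym Z u≢v c∈u′ c∈P′ comp′ fr′ iso′ d≢c (λ r → contradiction r iso)
    ; same-w = λ w≢u w≢v → same-trans (repaint-same R-sym X iso P w≢v)
        (join-same R-sym Z u≢v c∈u′ c∈P′ comp′ fr′ iso′ w≢u w≢v) }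
    where
    Z : Coloring R
    Z = repaint R-sym X iso P
    same-u : Same X Z u
    same-u = repaint-same R-sym X iso P u≢v
    c∈u′ : c ∈⁰ pal Z u
    c∈u′ = subst (c ∈⁰_) (sym (pal≡ same-u)) c∈u
    c∈P′ : c ∈⁰ pal Z v
    c∈P′ = subst (c ∈⁰_) (sym (repaint-pal R-sym X iso P)) c∈P
    comp′ : Compatible (pal Z u) (pal Z v) c
    comp′ s t = comp (subst (_ ∈ₚ_) (pal≡ same-u) s) (subst (_ ∈ₚ_) (repaint-pal R-sym X iso P) t)
    fr′ : Free Z u c
    fr′ = free-same same-u fr
    iso′ : Free Z v c
    iso′ r = contradiction r iso

-- Palettes on threads and where threads meet

strong-avoiding : (xs : List (Fin 5)) → length xs ℕ.< 5 → ∃ λ s → s ∉ xs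
strong-avoiding = fresh Fin._≟_ id id

-- Lists the strong colours of a palette with a given one first, so the avoidance lists below need
-- no split on its position.
other : ∀ P {s} → s ∈ₚ P → ∃ λ r → ∀ {t} → t ∈ₚ P → t ∈ s ∷ r ∷ []
other (palette p q _) (inj₁ refl) = q , λ { (inj₁ refl) → here refl ; (inj₂ refl) → there (here refl) }
other (palette p q _) (inj₂ refl) = p , λ { (inj₁ refl) → there (here refl) ; (inj₂ refl) → here refl }

pattern at0 = here refl
pattern at1 = there (here refl)
pattern at2 = there (there (here refl))
pattern at3 = there (there (there (here refl)))

_∌_ : Palette → Fin 5 → Set
P ∌ s = ¬ (s ∈ₚ P)

-- Excludes a common strong colour on the end edges of a thread with two inner vertices: both inner
-- palettes would contain it, and compatibility would force it on the middle edge too.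
Avoids : Color → Color → Set
Avoids α c = α ≡ nothing ⊎ α ≢ c

-- Palettes for a thread x – p₂ – p₁ – v whose ends x and v have palettes X and V
-- and whose edges have the colours α, b and c.
record Route₂ (X V : Palette) (α c : Color) : Set where
  field
    P₂ P₁ : Palette
    b     : Color
    α∈P₂  : α ∈⁰ P₂
    b∈P₂  : b ∈⁰ P₂
    b∈P₁  : b ∈⁰ P₁
    c∈P₁  : c ∈⁰ P₁
    X-P₂  : Compatible X P₂ α
    P₂-P₁ : Compatible P₂ P₁ b
    P₁-V  : Compatible P₁ V c
    b≢α   : b ≢ α
    c≢b   : c ≢ b

pattern first  = pick (inj₁ refl)
pattern second = pick (inj₂ refl)

-- The middle edge takes the matching colour if both end edges are strong, and otherwise a strong
-- colour outside `X` and `V`. Every new colour has at most four colours to avoid, so five strong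
-- colours suffice.
route₂ : ∀ {X V α c} → α ∈⁰ X → c ∈⁰ V → Avoids α c → Route₂ X V α c
route₂ {palette p q _} {V} {nothing} {just c} zero (pick c∈V) _
  with w , V⊆ ← other V c∈V
  with b , b∉ ← strong-avoiding (p ∷ q ∷ c ∷ w ∷ []) ℕ.≤-refl
  with e , e∉ ← strong-avoiding (p ∷ q ∷ b ∷ c ∷ []) ℕ.≤-refl = record
  { P₂ = palette b e (λ { refl → e∉ at2 })
  ; P₁ = palette b c (λ { refl → b∉ at2 })
  ; b = just b ; α∈P₂ = zero ; b∈P₂ = first ; b∈P₁ = first ; c∈P₁ = second
  ; X-P₂ = λ { (inj₁ refl) (inj₁ refl) → contradiction at0 b∉ ; (inj₂ refl) (inj₁ refl) → contradiction at1 b∉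
             ; (inj₁ refl) (inj₂ refl) → contradiction at0 e∉ ; (inj₂ refl) (inj₂ refl) → contradiction at1 e∉ }
  ; P₂-P₁ = λ { (inj₁ refl) _ → refl ; (inj₂ refl) (inj₁ refl) → refl ; (inj₂ refl) (inj₂ refl) → contradiction at3 e∉ }
  ; P₁-V = λ { (inj₂ refl) _ → refl ; (inj₁ refl) t → contradiction (there (there (V⊆ t))) b∉ }
  ; b≢α = λ () ; c≢b = λ { refl → b∉ at2 } }
route₂ {palette p q _} {palette v w _} {nothing} {nothing} zero zero _
  with b , b∉ ← strong-avoiding (p ∷ q ∷ v ∷ w ∷ []) ℕ.≤-refl
  with e , e∉ ← strong-avoiding (p ∷ q ∷ b ∷ []) (ℕ.n≤1+n _)
  with h , h∉ ← strong-avoiding (b ∷ v ∷ w ∷ e ∷ []) ℕ.≤-refl = record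
  { P₂ = palette b e (λ { refl → e∉ at2 })
  ; P₁ = palette b h (λ { refl → h∉ at0 })
  ; b = just b ; α∈P₂ = zero ; b∈P₂ = first ; b∈P₁ = first ; c∈P₁ = zero
  ; X-P₂ = λ { (inj₁ refl) (inj₁ refl) → contradiction at0 b∉ ; (inj₂ refl) (inj₁ refl) → contradiction at1 b∉
             ; (inj₁ refl) (inj₂ refl) → contradiction at0 e∉ ; (inj₂ refl) (inj₂ refl) → contradiction at1 e∉ }
  ; P₂-P₁ = λ { (inj₁ refl) _ → refl ; (inj₂ refl) (inj₁ refl) → refl ; (inj₂ refl) (inj₂ refl) → contradiction at3 h∉ }
  ; P₁-V = λ { (inj₁ refl) (inj₁ refl) → contradiction at2 b∉ ; (inj₁ refl) (inj₂ refl) → contradiction at3 b∉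
             ; (inj₂ refl) (inj₁ refl) → contradiction at1 h∉ ; (inj₂ refl) (inj₂ refl) → contradiction at2 h∉ }
  ; b≢α = λ () ; c≢b = λ () }
route₂ {X} {V} {just s} {just c} (pick s∈X) (pick c∈V) (inj₂ s≢c)
  with r , X⊆ ← other X s∈X | w , V⊆ ← other V c∈V
  with e , e∉ ← strong-avoiding (s ∷ r ∷ c ∷ []) (ℕ.n≤1+n _)
  with h , h∉ ← strong-avoiding (c ∷ w ∷ s ∷ e ∷ []) ℕ.≤-refl = record
  { P₂ = palette s e (λ { refl → e∉ at0 })
  ; P₁ = palette c h (λ { refl → h∉ at0 })
  ; b = nothing ; α∈P₂ = first ; b∈P₂ = zero ; b∈P₁ = zero ; c∈P₁ = first
  ; X-P₂ = λ { t (inj₁ refl) → refl ; t (inj₂ refl) → contradiction (∈-++⁺ˡ (X⊆ t)) e∉ }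
  ; P₂-P₁ = λ { (inj₁ refl) (inj₁ refl) → contradiction refl s≢c ; (inj₁ refl) (inj₂ refl) → contradiction at2 h∉
              ; (inj₂ refl) (inj₁ refl) → contradiction at2 e∉ ; (inj₂ refl) (inj₂ refl) → contradiction at3 h∉ }
  ; P₁-V = λ { (inj₁ refl) _ → refl ; (inj₂ refl) t → contradiction (∈-++⁺ˡ (V⊆ t)) h∉ }
  ; b≢α = λ () ; c≢b = λ () }
route₂ {X} {palette v w _} {just s} {nothing} (pick s∈X) zero _
  with r , X⊆ ← other X s∈X
  with b , b∉ ← strong-avoiding (s ∷ r ∷ v ∷ w ∷ []) ℕ.≤-refl
  with h , h∉ ← strong-avoiding (s ∷ b ∷ v ∷ w ∷ []) ℕ.≤-refl = record
  { P₂ = palette s b (λ { refl → b∉ at0 })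
  ; P₁ = palette b h (λ { refl → h∉ at1 })
  ; b = just b ; α∈P₂ = first ; b∈P₂ = second ; b∈P₁ = first ; c∈P₁ = zero
  ; X-P₂ = λ { t (inj₁ refl) → refl ; t (inj₂ refl) → contradiction (∈-++⁺ˡ (X⊆ t)) b∉ }
  ; P₂-P₁ = λ { (inj₂ refl) _ → refl ; (inj₁ refl) (inj₁ refl) → refl ; (inj₁ refl) (inj₂ refl) → contradiction at0 h∉ }
  ; P₁-V = λ { (inj₁ refl) (inj₁ refl) → contradiction at2 b∉ ; (inj₁ refl) (inj₂ refl) → contradiction at3 b∉
             ; (inj₂ refl) (inj₁ refl) → contradiction at2 h∉ ; (inj₂ refl) (inj₂ refl) → contradiction at3 h∉ }
  ; b≢α = λ { refl → b∉ at0 } ; c≢b = λ () }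
route₂ {α = just _} {c = just _} _ _ (inj₁ ())

-- This is not the negation of `_∈⁰_`: the matching colour satisfies both for every palette.
_∉⁰_ : Color → Palette → Set
c ∉⁰ P = ∀ {s} → c ≡ just s → P ∌ s

-- A thread x - p - v with end palettes `X` and `V` and edge colours `α` and `c`; the palette of p
-- is `P`.
record Route₁ (X V : Palette) (α c : Color) : Set where
  field
    P   : Palette
    α∈P : α ∈⁰ P
    c∈P : c ∈⁰ P
    X-P : Compatible X P α
    P-V : Compatible P V c

-- `P` has to contain both `α` and `c`. A strong `c` in `X`, or a strong `α` in `V`, would then be a
-- second shared colour across one of the two edges.
route₁ : ∀ {X V α c} → α ∈⁰ X → c ∈⁰ V → c ∉⁰ X → α ∉⁰ V → α ≢ c → Route₁ X V α c
route₁ {α = nothing} {nothing} _ _ _ _ α≢c = contradiction refl α≢c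
route₁ {palette p q _} {V} {nothing} {just c} _ (pick c∈V) c∉X _ _
  with w , V⊆ ← other V c∈V
  with h , h∉ ← strong-avoiding (p ∷ q ∷ c ∷ w ∷ []) ℕ.≤-refl = record
  { P = palette c h (λ { refl → h∉ at2 })
  ; α∈P = zero ; c∈P = first
  ; X-P = λ { t (inj₁ refl) → contradiction t (c∉X refl)
            ; (inj₁ refl) (inj₂ refl) → contradiction at0 h∉ ; (inj₂ refl) (inj₂ refl) → contradiction at1 h∉ }
  ; P-V = λ { (inj₁ refl) _ → refl ; (inj₂ refl) t → contradiction (there (there (V⊆ t))) h∉ } }
route₁ {X} {palette v w _} {just s} {nothing} (pick s∈X) _ _ s∉V _
  with r , X⊆ ← other X s∈X
  with h , h∉ ← strong-avoiding (v ∷ w ∷ s ∷ r ∷ []) ℕ.≤-refl = record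
  { P = palette s h (λ { refl → h∉ at2 })
  ; α∈P = first ; c∈P = zero
  ; X-P = λ { t (inj₁ refl) → refl ; t (inj₂ refl) → contradiction (there (there (X⊆ t))) h∉ }
  ; P-V = λ { (inj₁ refl) t → contradiction t (s∉V refl)
            ; (inj₂ refl) (inj₁ refl) → contradiction at0 h∉ ; (inj₂ refl) (inj₂ refl) → contradiction at1 h∉ } }
route₁ {α = just s} {just c} (pick s∈X) (pick c∈V) c∉X s∉V α≢c = record
  { P = palette s c (α≢c ∘ cong just)
  ; α∈P = first ; c∈P = second
  ; X-P = λ { t (inj₁ refl) → refl ; t (inj₂ refl) → contradiction t (c∉X refl) }
  ; P-V = λ { (inj₁ refl) t → contradiction t (s∉V refl) ; (inj₂ refl) _ → refl } }

record Leaf (X : Palette) (α : Color) : Set where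
  field
    P   : Palette
    α∈P : α ∈⁰ P
    X-P : Compatible X P α

leaf-palette : ∀ {X α} → α ∈⁰ X → Leaf X α
leaf-palette {palette p q _} {nothing} _
  with s , s∉ ← strong-avoiding (p ∷ q ∷ []) (ℕ.m≤m+n 3 2)
  with t , t∉ ← strong-avoiding (p ∷ q ∷ s ∷ []) (ℕ.n≤1+n _) = record
  { P = palette s t (λ { refl → t∉ at2 })
  ; α∈P = zero
  ; X-P = λ { (inj₁ refl) (inj₁ refl) → contradiction at0 s∉ ; (inj₂ refl) (inj₁ refl) → contradiction at1 s∉
            ; (inj₁ refl) (inj₂ refl) → contradiction at0 t∉ ; (inj₂ refl) (inj₂ refl) → contradiction at1 t∉ } }
leaf-palette {X} {just s} (pick s∈X)
  with r , X⊆ ← other X s∈X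
  with t , t∉ ← strong-avoiding (s ∷ r ∷ []) (ℕ.m≤m+n 3 2) = record
  { P = palette s t (λ { refl → t∉ at0 })
  ; α∈P = first
  ; X-P = λ { u (inj₁ refl) → refl ; u (inj₂ refl) → contradiction (X⊆ u) t∉ } }

-- Puts an arbitrary colour on a list of strong colours to avoid; for the matching colour the
-- default `zero` merely forbids one colour more.
shade : Color → Fin 5
shade nothing  = zero
shade (just s) = s

avoids-shade : ∀ α {c} → shade α ≢ c → Avoids α (just c)
avoids-shade nothing  _ = inj₁ refl
avoids-shade (just s) s≢c = inj₂ λ { refl → s≢c refl }

avoids-nothing : ∀ α → Avoids α nothing
avoids-nothing nothing  = inj₁ refl
avoids-nothing (just _) = inj₂ λ ()

-- A palette V for the vertex v of a (2,2,0) configuration. The edge from v to the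
-- vertex with palette Γ has colour γ, and the outer edges of the two threads,
-- which leave v with colours c and d, have the colours α and β.
record Centre₂₂ (Γ : Palette) (γ α β : Color) : Set where
  field
    V   : Palette
    c d : Color
    γ∈V : γ ∈⁰ V
    c∈V : c ∈⁰ V
    d∈V : d ∈⁰ V
    Γ-V : Compatible Γ V γ
    c≢γ : c ≢ γ
    d≢γ : d ≢ γ
    d≢c : d ≢ c
    α-c : Avoids α c
    β-d : Avoids β d

-- If `γ` is the matching colour, both threads leave by strong colours outside `Γ`. If `γ` is
-- strong, the first thread takes the matching colour, and only `d` has to be chosen.
centre₂₂ : ∀ {Γ γ} α β → γ ∈⁰ Γ → Centre₂₂ Γ γ α β
centre₂₂ {palette p q _} {nothing} α β _
  with c , c∉ ← strong-avoiding (p ∷ q ∷ shade α ∷ []) (ℕ.n≤1+n _)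
  with d , d∉ ← strong-avoiding (p ∷ q ∷ shade β ∷ c ∷ []) ℕ.≤-refl = record
  { V = palette c d (λ { refl → d∉ at3 }) ; c = just c ; d = just d
  ; γ∈V = zero ; c∈V = first ; d∈V = second
  ; Γ-V = λ { (inj₁ refl) (inj₁ refl) → contradiction at0 c∉ ; (inj₂ refl) (inj₁ refl) → contradiction at1 c∉
            ; (inj₁ refl) (inj₂ refl) → contradiction at0 d∉ ; (inj₂ refl) (inj₂ refl) → contradiction at1 d∉ }
  ; c≢γ = λ () ; d≢γ = λ () ; d≢c = λ { refl → d∉ at3 }
  ; α-c = avoids-shade α (λ { refl → c∉ at2 }) ; β-d = avoids-shade β (λ { refl → d∉ at2 }) }
centre₂₂ {Γ} {just g} α β (pick g∈Γ)
  with r , Γ⊆ ← other Γ g∈Γ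
  with d , d∉ ← strong-avoiding (shade β ∷ g ∷ r ∷ []) (ℕ.n≤1+n _) = record
  { V = palette g d (λ { refl → d∉ at1 }) ; c = nothing ; d = just d
  ; γ∈V = first ; c∈V = zero ; d∈V = second
  ; Γ-V = λ { t (inj₁ refl) → refl ; t (inj₂ refl) → contradiction (there (Γ⊆ t)) d∉ }
  ; c≢γ = λ () ; d≢γ = λ { refl → d∉ at1 } ; d≢c = λ ()
  ; α-c = avoids-nothing α ; β-d = avoids-shade β (λ { refl → d∉ at0 }) }

-- A palette V for the vertex v of a (2,1,1) configuration, whose short threads
-- end at vertices with palettes X and Y. The outer edges of the threads have the
-- colours α, β and γ, and their edges at v the colours b, c and d.
record Centre₁₁₂ (X Y : Palette) (α β γ : Color) : Set where
  field
    V     : Palette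
    b c d : Color
    b∈V   : b ∈⁰ V
    c∈V   : c ∈⁰ V
    d∈V   : d ∈⁰ V
    c≢b   : c ≢ b
    d≢b   : d ≢ b
    d≢c   : d ≢ c
    b∉X   : b ∉⁰ X
    α∉V   : α ∉⁰ V
    α≢b   : α ≢ b
    c∉Y   : c ∉⁰ Y
    β∉V   : β ∉⁰ V
    β≢c   : β ≢ c
    γ-d   : Avoids γ d

just-∉⁰ : ∀ P {s} → P ∌ s → just s ∉⁰ P
just-∉⁰ _ ∌s refl = ∌s

-- A short thread cannot have the matching colour on both of its edges. So at `v` the matching
-- colour goes to a short thread whose outer edge is strong, or to the long thread if there is none.
centre₁₁₂ : ∀ {X Y α β} γ → α ∈⁰ X → β ∈⁰ Y → Centre₁₁₂ X Y α β γ
centre₁₁₂ {X@(palette p q _)} {Y@(palette p′ q′ _)} {nothing} {nothing} γ _ _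
  with b , b∉ ← strong-avoiding (p ∷ q ∷ []) (ℕ.m≤m+n 3 2)
  with c , c∉ ← strong-avoiding (p′ ∷ q′ ∷ b ∷ []) (ℕ.n≤1+n _) = record
  { V = palette b c (λ { refl → c∉ at2 }) ; b = just b ; c = just c ; d = nothing
  ; b∈V = first ; c∈V = second ; d∈V = zero
  ; c≢b = λ { refl → c∉ at2 } ; d≢b = λ () ; d≢c = λ ()
  ; b∉X = just-∉⁰ X (λ { (inj₁ refl) → b∉ at0 ; (inj₂ refl) → b∉ at1 }) ; α∉V = λ () ; α≢b = λ ()
  ; c∉Y = just-∉⁰ Y (λ { (inj₁ refl) → c∉ at0 ; (inj₂ refl) → c∉ at1 }) ; β∉V = λ () ; β≢c = λ ()
  ; γ-d = avoids-nothing γ }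
centre₁₁₂ {X@(palette p q _)} {Y} {nothing} {just s} γ _ _
  with b , b∉ ← strong-avoiding (p ∷ q ∷ s ∷ []) (ℕ.n≤1+n _)
  with d , d∉ ← strong-avoiding (b ∷ s ∷ shade γ ∷ []) (ℕ.n≤1+n _) = record
  { V = palette b d (λ { refl → d∉ at0 }) ; b = just b ; c = nothing ; d = just d
  ; b∈V = first ; c∈V = zero ; d∈V = second
  ; c≢b = λ () ; d≢b = λ { refl → d∉ at0 } ; d≢c = λ ()
  ; b∉X = just-∉⁰ X (λ { (inj₁ refl) → b∉ at0 ; (inj₂ refl) → b∉ at1 }) ; α∉V = λ () ; α≢b = λ ()
  ; c∉Y = λ () ; β∉V = just-∉⁰ (palette b d (λ { refl → d∉ at0 })) (λ { (inj₁ refl) → b∉ at2 ; (inj₂ refl) → d∉ at1 }) ; β≢c = λ ()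
  ; γ-d = avoids-shade γ (λ { refl → d∉ at2 }) }
centre₁₁₂ {X} {Y@(palette p q _)} {just s} {nothing} γ _ _
  with c , c∉ ← strong-avoiding (p ∷ q ∷ s ∷ []) (ℕ.n≤1+n _)
  with d , d∉ ← strong-avoiding (c ∷ s ∷ shade γ ∷ []) (ℕ.n≤1+n _) = record
  { V = palette c d (λ { refl → d∉ at0 }) ; b = nothing ; c = just c ; d = just d
  ; b∈V = zero ; c∈V = first ; d∈V = second
  ; c≢b = λ () ; d≢b = λ () ; d≢c = λ { refl → d∉ at0 }
  ; b∉X = λ () ; α∉V = just-∉⁰ (palette c d (λ { refl → d∉ at0 })) (λ { (inj₁ refl) → c∉ at2 ; (inj₂ refl) → d∉ at1 }) ; α≢b = λ ()
  ; c∉Y = just-∉⁰ Y (λ { (inj₁ refl) → c∉ at0 ; (inj₂ refl) → c∉ at1 }) ; β∉V = λ () ; β≢c = λ ()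
  ; γ-d = avoids-shade γ (λ { refl → d∉ at2 }) }
centre₁₁₂ {X} {Y@(palette p q _)} {just s} {just t} γ _ (pick t∈Y)
  with c , c∉ ← strong-avoiding (p ∷ q ∷ s ∷ []) (ℕ.n≤1+n _)
  with d , d∉ ← strong-avoiding (c ∷ s ∷ t ∷ shade γ ∷ []) ℕ.≤-refl = record
  { V = palette c d (λ { refl → d∉ at0 }) ; b = nothing ; c = just c ; d = just d
  ; b∈V = zero ; c∈V = first ; d∈V = second
  ; c≢b = λ () ; d≢b = λ () ; d≢c = λ { refl → d∉ at0 }
  ; b∉X = λ () ; α∉V = just-∉⁰ (palette c d (λ { refl → d∉ at0 })) (λ { (inj₁ refl) → c∉ at2 ; (inj₂ refl) → d∉ at1 }) ; α≢b = λ ()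
  ; c∉Y = just-∉⁰ Y c∉Y ; β∉V = just-∉⁰ (palette c d (λ { refl → d∉ at0 })) (λ { (inj₁ refl) → c∉Y t∈Y ; (inj₂ refl) → d∉ at2 })
  ; β≢c = λ { refl → c∉Y t∈Y }
  ; γ-d = avoids-shade γ (λ { refl → d∉ at3 }) }
  where
  c∉Y : Y ∌ c
  c∉Y = λ { (inj₁ refl) → c∉ at0 ; (inj₂ refl) → c∉ at1 }

-- Attaching threads to a colouring

open Coloring
open Same

colors : Palette → Fin 3 → Color
colors P zero             = nothing
colors P (suc zero)       = just (Palette.p P)
colors P (suc (suc zero)) = just (Palette.q P)

colors∈ : ∀ P i → colors P i ∈⁰ P
colors∈ P zero             = zero
colors∈ P (suc zero)       = pick (inj₁ refl)
colors∈ P (suc (suc zero)) = pick (inj₂ refl)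

colors-injective : ∀ P → Injective _≡_ _≡_ (colors P)
colors-injective P {zero}           {zero}           _  = refl
colors-injective P {suc zero}       {suc zero}       _  = refl
colors-injective P {suc (suc zero)} {suc (suc zero)} _  = refl
colors-injective P {zero}           {suc zero}       ()
colors-injective P {zero}           {suc (suc zero)} ()
colors-injective P {suc zero}       {suc (suc zero)} eq = contradiction (just-injective eq) (Palette.p≢q P)
colors-injective P {suc (suc zero)} {suc zero}       eq = contradiction (just-injective (sym eq)) (Palette.p≢q P)

-- What the next thread at `v` relies on: the palette of `v` is unchanged, one colour there is used
-- up, and vertices off the thread are untouched.
record Branched {R R⁺ : Rel (Fin n) 0ℓ} (X : Coloring R) (Y : Coloring R⁺) (v : Fin n) (c : Color) (ws : List (Fin n)) : Set where
  field
    pal-v  : pal Y v ≡ pal X v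
    free-v : ∀ {d} → d ≢ c → Free X v d → Free Y v d
    same-w : ∀ {w} → w ≢ v → All (w ≢_) ws → Same X Y w

module _ {R : Rel (Fin n) 0ℓ} (R-sym : Symmetric R) (X : Coloring R) where

  opaque

    -- The inner vertex is hung on `x` while it is isolated, which fixes its palette; only the last
    -- edge joins two vertices whose palettes are already fixed.
    branch₁ : ∀ {x a v α c} → Unique (x ∷ a ∷ v ∷ []) → Isolated R a →
              α ∈⁰ pal X x → c ∈⁰ pal X v → c ∉⁰ pal X x → α ∉⁰ pal X v → α ≢ c → Free X x α → Free X v c →
              Σ (Coloring (R +[ x - a ] +[ a - v ])) λ Y → Branched X Y v c (x ∷ a ∷ [])
    branch₁ {x} {a} {v} {α} {c} ((x≢a ∷ x≢v ∷ []) ∷ (a≢v ∷ []) ∷ _) iso α∈ c∈ c∉ α∉ α≢c free-x free-v = Z , record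
      { pal-v = pal≡ same-v
      ; free-v = λ d≢c fr → join-free (+-symmetric R-sym) Y a≢v c∈a c∈v comp free-a free-v′ d≢c (free-same same-v fr)
      ; same-w = λ { w≢v (w≢x ∷ w≢a ∷ []) → same-trans (Attached.same-w att w≢x w≢a) (join-same (+-symmetric R-sym) Y a≢v c∈a c∈v comp free-a free-v′ w≢a w≢v) } }
      where
      route : Route₁ (pal X x) (pal X v) α c
      route = route₁ α∈ c∈ c∉ α∉ α≢c
      open Route₁ route
      att : Attached X x a α P
      att = attach R-sym X x≢a iso α∈ α∈P X-P free-x
      open Attached att using (Y)
      same-v : Same X Y v
      same-v = Attached.same-w att (≢-sym x≢v) (≢-sym a≢v)
      c∈a : c ∈⁰ pal Y a
      c∈a = subst (c ∈⁰_) (sym (Attached.pal-v att)) c∈P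
      c∈v : c ∈⁰ pal Y v
      c∈v = subst (c ∈⁰_) (sym (pal≡ same-v)) c∈
      comp : Compatible (pal Y a) (pal Y v) c
      comp s t = P-V (subst (_ ∈ₚ_) (Attached.pal-v att) s) (subst (_ ∈ₚ_) (pal≡ same-v) t)
      free-a : Free Y a c
      free-a = Attached.free-v att (≢-sym α≢c)
      free-v′ : Free Y v c
      free-v′ = free-same same-v free-v
      Z : Coloring (R +[ x - a ] +[ a - v ])
      Z = join (+-symmetric R-sym) Y a≢v c∈a c∈v comp free-a free-v′

    branch₂ : ∀ {x a′ a v α c} → Unique (x ∷ a′ ∷ a ∷ v ∷ []) → Isolated R a′ → Isolated R a →
              α ∈⁰ pal X x → c ∈⁰ pal X v → Avoids α c → Free X x α → Free X v c →
              Σ (Coloring (R +[ x - a′ ] +[ a′ - a ] +[ a - v ])) λ Y → Branched X Y v c (x ∷ a′ ∷ a ∷ [])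
    branch₂ {x} {a′} {a} {v} {α} {c} ((x≢a′ ∷ x≢a ∷ x≢v ∷ []) ∷ (a′≢a ∷ a′≢v ∷ []) ∷ (a≢v ∷ []) ∷ _)
      iso′ iso α∈ c∈ avoids free-x free-v = Z , record
      { pal-v = pal≡ same-v
      ; free-v = λ d≢c fr → join-free (+-symmetric (+-symmetric R-sym)) Y a≢v c∈a c∈v comp free-a free-v′ d≢c (free-same same-v fr)
      ; same-w = λ { w≢v (w≢x ∷ w≢a′ ∷ w≢a ∷ []) →
          same-trans (Attached.same-w att₂ w≢x w≢a′) (same-trans (Attached.same-w att₁ w≢a′ w≢a)
            (join-same (+-symmetric (+-symmetric R-sym)) Y a≢v c∈a c∈v comp free-a free-v′ w≢a w≢v)) } }
      where
      route : Route₂ (pal X x) (pal X v) α c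
      route = route₂ α∈ c∈ avoids
      open Route₂ route
      att₂ : Attached X x a′ α P₂
      att₂ = attach R-sym X x≢a′ iso′ α∈ α∈P₂ X-P₂ free-x
      module X₂ = Attached att₂
      att₁ : Attached X₂.Y a′ a b P₁
      att₁ = attach (+-symmetric R-sym) X₂.Y a′≢a (isolated-same (X₂.same-w (≢-sym x≢a) (≢-sym a′≢a)) iso)
               (subst (b ∈⁰_) (sym X₂.pal-v) b∈P₂) b∈P₁
               (λ s t → P₂-P₁ (subst (_ ∈ₚ_) X₂.pal-v s) t) (X₂.free-v b≢α)
      open Attached att₁ using (Y)
      same-v : Same X Y v
      same-v = same-trans (X₂.same-w (≢-sym x≢v) (≢-sym a′≢v)) (Attached.same-w att₁ (≢-sym a′≢v) (≢-sym a≢v))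
      c∈a : c ∈⁰ pal Y a
      c∈a = subst (c ∈⁰_) (sym (Attached.pal-v att₁)) c∈P₁
      c∈v : c ∈⁰ pal Y v
      c∈v = subst (c ∈⁰_) (sym (pal≡ same-v)) c∈
      comp : Compatible (pal Y a) (pal Y v) c
      comp s t = P₁-V (subst (_ ∈ₚ_) (Attached.pal-v att₁) s) (subst (_ ∈ₚ_) (pal≡ same-v) t)
      free-a : Free Y a c
      free-a = Attached.free-v att₁ c≢b
      free-v′ : Free Y v c
      free-v′ = free-same same-v free-v
      Z : Coloring (R +[ x - a′ ] +[ a′ - a ] +[ a - v ])
      Z = join (+-symmetric (+-symmetric R-sym)) Y a≢v c∈a c∈v comp free-a free-v′

  -- With the matching colour the palette has three colours, and at most two edges are left at `x`.
  free-color : ∀ {x a b} → (∀ {y} → R x y → y ∈ a ∷ b ∷ []) → ∃ λ α → α ∈⁰ pal X x × Free X x α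
  free-color {x} {a} {b} nbrs
    with fresh (Maybe.≡-dec Fin._≟_) (colors (pal X x)) (colors-injective _) (κ X x a ∷ κ X x b ∷ []) ℕ.≤-refl
  ... | i , ∉κ = _ , colors∈ _ i , λ r eq → ∉κ (used (nbrs r) (sym eq))
    where
    used : ∀ {y c} → y ∈ a ∷ b ∷ [] → c ≡ κ X x y → c ∈ κ X x a ∷ κ X x b ∷ []
    used at0 refl = here refl
    used at1 refl = there (here refl)

-- Reducible configurations

opaque

  delete : (Fin n → Fin n → Bool) → List (Fin n) → Fin n → Fin n → Bool
  delete S W x y = S x y ∧ isNo (x ∈? W) ∧ isNo (y ∈? W)
    where open DecMembership Fin._≟_ using (_∈?_)

  delete⁻ : ∀ {S : Fin n → Fin n → Bool} {W x y} → T (delete S W x y) → T (S x y) × x ∉ W × y ∉ W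
  delete⁻ {S = S} {W} {x} {y} p =
    let s , q   = Equivalence.to (T-∧ {S x y}) p
        x∉ , y∉ = Equivalence.to (T-∧ {isNo (x ∈? W)}) q
    in s , toWitnessFalse {a? = x ∈? W} x∉ , toWitnessFalse {a? = y ∈? W} y∉
    where open DecMembership Fin._≟_ using (_∈?_)

  delete⁺ : ∀ {S : Fin n → Fin n → Bool} {W x y} → T (S x y) → x ∉ W → y ∉ W → T (delete S W x y)
  delete⁺ {S = S} {W} {x} {y} s x∉ y∉ = Equivalence.from (T-∧ {S x y}) (s ,
    Equivalence.from (T-∧ {isNo (x ∈? W)}) (fromWitnessFalse {a? = x ∈? W} x∉ , fromWitnessFalse {a? = y ∈? W} y∉))
    where open DecMembership Fin._≟_ using (_∈?_)

delete-sym : (S : Fin n → Fin n → Bool) → Symmetric (λ x y → T (S x y)) →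
             ∀ W → Symmetric (λ x y → T (delete S W x y))
delete-sym S S-sym W r = let s , x∉ , y∉ = delete⁻ {S = S} {W} r in delete⁺ {S = S} {W} (S-sym s) y∉ x∉

pattern →e = new (inj₁ (refl , refl))
pattern ←e = new (inj₂ (refl , refl))

module _ {R : Rel (Fin n) 0ℓ} (R-sym : Symmetric R) (X : Coloring R) where

  -- Here `c` acts as the centre of a (2,2,0) configuration whose second thread is missing, so
  -- `nothing` stands for the colour of that thread's outer edge.
  extend-path : ∀ {x a b c y α γ} → Unique (x ∷ a ∷ b ∷ c ∷ y ∷ []) →
                Isolated R a → Isolated R b → Isolated R c →
                α ∈⁰ pal X x → Free X x α → γ ∈⁰ pal X y → Free X y γ →
                Centre₂₂ (pal X y) γ α nothing →
                Coloring (R +[ y - c ] +[ x - a ] +[ a - b ] +[ b - c ])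
  extend-path {x} {a} {b} {c} {y} {α} {γ}
    ((x≢a ∷ x≢b ∷ x≢c ∷ x≢y ∷ []) ∷ (a≢b ∷ a≢c ∷ a≢y ∷ []) ∷ (b≢c ∷ b≢y ∷ []) ∷ (c≢y ∷ []) ∷ _)
    iso-a iso-b iso-c α∈ free-x γ∈ free-y C
    = proj₁ (branch₂ (+-symmetric R-sym) X₁.Y ((x≢a ∷ x≢b ∷ x≢c ∷ []) ∷ (a≢b ∷ a≢c ∷ []) ∷ (b≢c ∷ []) ∷ [] ∷ [])
        (isolated-same (X₁.same-w a≢y a≢c) iso-a) (isolated-same (X₁.same-w b≢y b≢c) iso-b)
        (subst (α ∈⁰_) (sym (pal≡ same-x)) α∈) (subst (C.c ∈⁰_) (sym X₁.pal-v) C.c∈V)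
        C.α-c (free-same same-x free-x) (X₁.free-v C.c≢γ))
    where
    module C = Centre₂₂ C
    module X₁ = Attached (attach R-sym X (≢-sym c≢y) iso-c γ∈ C.γ∈V C.Γ-V free-y)
    same-x : Same X X₁.Y x
    same-x = X₁.same-w x≢y x≢c

  -- The edge to `u` comes first because the palette of `v` must be compatible with that of `u`.
  -- Each thread then uses a colour at `v` that the earlier edges have left free.
  extend₂₂ : ∀ {x a′ a v b b′ y u α β γ} →
             Unique (x ∷ a′ ∷ a ∷ v ∷ b ∷ b′ ∷ y ∷ []) → All (u ≢_) (x ∷ a′ ∷ a ∷ v ∷ b ∷ b′ ∷ y ∷ []) →
             Isolated R a′ → Isolated R a → Isolated R v → Isolated R b → Isolated R b′ →
             α ∈⁰ pal X x → Free X x α → β ∈⁰ pal X y → Free X y β → γ ∈⁰ pal X u → Free X u γ →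
             Centre₂₂ (pal X u) γ α β →
             Coloring (R +[ u - v ] +[ x - a′ ] +[ a′ - a ] +[ a - v ] +[ y - b′ ] +[ b′ - b ] +[ b - v ])
  extend₂₂ {x} {a′} {a} {v} {b} {b′} {y} {u} {α} {β} {γ}
    ( (x≢a′ ∷ x≢a ∷ x≢v ∷ x≢b ∷ x≢b′ ∷ x≢y ∷ [])
    ∷ (a′≢a ∷ a′≢v ∷ a′≢b ∷ a′≢b′ ∷ a′≢y ∷ [])
    ∷ (a≢v ∷ a≢b ∷ a≢b′ ∷ a≢y ∷ [])
    ∷ (v≢b ∷ v≢b′ ∷ v≢y ∷ [])
    ∷ (b≢b′ ∷ b≢y ∷ [])
    ∷ (b′≢y ∷ []) ∷ _)
    (u≢x ∷ u≢a′ ∷ u≢a ∷ u≢v ∷ u≢b ∷ u≢b′ ∷ u≢y ∷ [])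
    iso-a′ iso-a iso-v iso-b iso-b′ α∈ free-x β∈ free-y γ∈ free-u C
    = proj₁ (branch₂ sym₂ Z ((≢-sym b′≢y ∷ ≢-sym b≢y ∷ ≢-sym v≢y ∷ []) ∷ (≢-sym b≢b′ ∷ ≢-sym v≢b′ ∷ []) ∷ (≢-sym v≢b ∷ []) ∷ [] ∷ [])
        (isolated-same same-b′ iso-b′) (isolated-same same-b iso-b)
        (subst (β ∈⁰_) (sym (pal≡ same-y)) β∈) (subst (C.d ∈⁰_) (sym (trans X₂.pal-v X₁.pal-v)) C.d∈V)
        C.β-d (free-same same-y free-y) (X₂.free-v C.d≢c (X₁.free-v C.d≢γ)))
    where
    module C = Centre₂₂ C
    module X₁ = Attached (attach R-sym X u≢v iso-v γ∈ C.γ∈V C.Γ-V free-u)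
    same-x : Same X X₁.Y x
    same-x = X₁.same-w (≢-sym u≢x) x≢v
    branch : Σ (Coloring (R +[ u - v ] +[ x - a′ ] +[ a′ - a ] +[ a - v ])) λ Y → Branched X₁.Y Y v C.c (x ∷ a′ ∷ a ∷ [])
    branch = branch₂ (+-symmetric R-sym) X₁.Y ((x≢a′ ∷ x≢a ∷ x≢v ∷ []) ∷ (a′≢a ∷ a′≢v ∷ []) ∷ (a≢v ∷ []) ∷ [] ∷ [])
           (isolated-same (X₁.same-w (≢-sym u≢a′) a′≢v) iso-a′)
           (isolated-same (X₁.same-w (≢-sym u≢a) a≢v) iso-a)
           (subst (α ∈⁰_) (sym (pal≡ same-x)) α∈) (subst (C.c ∈⁰_) (sym X₁.pal-v) C.c∈V)
           C.α-c (free-same same-x free-x) (X₁.free-v C.c≢γ)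
    Z = proj₁ branch
    module X₂ = Branched (proj₂ branch)
    sym₂ = +-symmetric (+-symmetric (+-symmetric (+-symmetric R-sym)))
    same₂ : ∀ {w} → u ≢ w → v ≢ w → x ≢ w → a′ ≢ w → a ≢ w → Same X Z w
    same₂ u≢ v≢ x≢ a′≢ a≢ = same-trans (X₁.same-w (≢-sym u≢) (≢-sym v≢)) (X₂.same-w (≢-sym v≢) (≢-sym x≢ ∷ ≢-sym a′≢ ∷ ≢-sym a≢ ∷ []))
    same-y : Same X Z y
    same-y = same₂ u≢y v≢y x≢y a′≢y a≢y
    same-b : Same X Z b
    same-b = same₂ u≢b v≢b x≢b a′≢b a≢b
    same-b′ : Same X Z b′
    same-b′ = same₂ u≢b′ v≢b′ x≢b′ a′≢b′ a≢b′

  -- All three edges at `v` lead to deleted vertices, so the palette of `v` is set outright and the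
  -- threads are grown towards it, the short ones first.
  extend₁₁₂ : ∀ {x a′ a v b y c z α β γ} →
              Unique (x ∷ a′ ∷ a ∷ v ∷ b ∷ y ∷ []) → Unique (x ∷ a′ ∷ a ∷ v ∷ c ∷ z ∷ []) → Unique (y ∷ b ∷ v ∷ c ∷ z ∷ []) →
              Isolated R a′ → Isolated R a → Isolated R v → Isolated R b → Isolated R c →
              α ∈⁰ pal X y → Free X y α → β ∈⁰ pal X z → Free X z β → γ ∈⁰ pal X x → Free X x γ →
              Centre₁₁₂ (pal X y) (pal X z) α β γ →
              Coloring (R +[ y - b ] +[ b - v ] +[ z - c ] +[ c - v ] +[ x - a′ ] +[ a′ - a ] +[ a - v ])
  extend₁₁₂ {x} {a′} {a} {v} {b} {y} {c} {z} {α} {β} {γ}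
    ( (x≢a′ ∷ x≢a ∷ x≢v ∷ x≢b ∷ x≢y ∷ [])
    ∷ (a′≢a ∷ a′≢v ∷ a′≢b ∷ a′≢y ∷ [])
    ∷ (a≢v ∷ a≢b ∷ a≢y ∷ [])
    ∷ (v≢b ∷ v≢y ∷ [])
    ∷ (b≢y ∷ []) ∷ _)
    ((_ ∷ _ ∷ _ ∷ x≢c ∷ x≢z ∷ []) ∷ (_ ∷ _ ∷ a′≢c ∷ a′≢z ∷ []) ∷ (_ ∷ a≢c ∷ a≢z ∷ []) ∷ (v≢c ∷ v≢z ∷ []) ∷ (c≢z ∷ []) ∷ _)
    ((_ ∷ _ ∷ y≢c ∷ y≢z ∷ []) ∷ (_ ∷ b≢c ∷ b≢z ∷ []) ∷ _)
    iso-a′ iso-a iso-v iso-b iso-c α∈ free-y β∈ free-z γ∈ free-x C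
    = proj₁ (branch₂ sym₂ X₂.Y ((x≢a′ ∷ x≢a ∷ x≢v ∷ []) ∷ (a′≢a ∷ a′≢v ∷ []) ∷ (a≢v ∷ []) ∷ [] ∷ [])
        (isolated-same (same₂ a′≢v a′≢y a′≢b a′≢z a′≢c) iso-a′)
        (isolated-same (same₂ a≢v a≢y a≢b a≢z a≢c) iso-a)
        (subst (γ ∈⁰_) (sym (pal≡ same-x)) γ∈) (subst (C.d ∈⁰_) (sym (trans X₂.pal-v pal₁)) C.d∈V)
        C.γ-d (free-same same-x free-x) (X₂.free-v C.d≢c (X₁.free-v C.d≢b free₀)))
    where
    module C = Centre₁₁₂ C
    X₀ : Coloring R
    X₀ = repaint R-sym X iso-v C.V
    same₀ : ∀ {w} → w ≢ v → Same X X₀ w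
    same₀ = repaint-same R-sym X iso-v C.V
    pal₀ : pal X₀ v ≡ C.V
    pal₀ = repaint-pal R-sym X iso-v C.V
    free₀ : ∀ {k} → Free X₀ v k
    free₀ r = contradiction r iso-v
    branch-b : Σ (Coloring (R +[ y - b ] +[ b - v ])) λ Y → Branched X₀ Y v C.b (y ∷ b ∷ [])
    branch-b = branch₁ R-sym X₀ ((≢-sym b≢y ∷ ≢-sym v≢y ∷ []) ∷ (≢-sym v≢b ∷ []) ∷ [] ∷ []) iso-b
           (subst (α ∈⁰_) (sym (pal≡ (same₀ (≢-sym v≢y)))) α∈) (subst (C.b ∈⁰_) (sym pal₀) C.b∈V)
           (subst (C.b ∉⁰_) (sym (pal≡ (same₀ (≢-sym v≢y)))) C.b∉X) (subst (α ∉⁰_) (sym pal₀) C.α∉V) C.α≢b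
           (free-same (same₀ (≢-sym v≢y)) free-y) free₀
    module X₁ where
      Y = proj₁ branch-b
      open Branched (proj₂ branch-b) public
    sym₁ = +-symmetric (+-symmetric R-sym)
    same₁ : ∀ {w} → w ≢ v → w ≢ y → w ≢ b → Same X X₁.Y w
    same₁ w≢v w≢y w≢b = same-trans (same₀ w≢v) (X₁.same-w w≢v (w≢y ∷ w≢b ∷ []))
    pal₁ : pal X₁.Y v ≡ C.V
    pal₁ = trans X₁.pal-v pal₀
    same-z : Same X X₁.Y z
    same-z = same₁ (≢-sym v≢z) (≢-sym y≢z) (≢-sym b≢z)
    branch-c : Σ (Coloring (R +[ y - b ] +[ b - v ] +[ z - c ] +[ c - v ])) λ Y → Branched X₁.Y Y v C.c (z ∷ c ∷ [])
    branch-c = branch₁ sym₁ X₁.Y ((≢-sym c≢z ∷ ≢-sym v≢z ∷ []) ∷ (≢-sym v≢c ∷ []) ∷ [] ∷ [])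
           (isolated-same (same₁ (≢-sym v≢c) (≢-sym y≢c) (≢-sym b≢c)) iso-c)
           (subst (β ∈⁰_) (sym (pal≡ same-z)) β∈) (subst (C.c ∈⁰_) (sym pal₁) C.c∈V)
           (subst (C.c ∉⁰_) (sym (pal≡ same-z)) C.c∉Y) (subst (β ∉⁰_) (sym pal₁) C.β∉V) C.β≢c
           (free-same same-z free-z) (X₁.free-v C.c≢b free₀)
    module X₂ where
      Y = proj₁ branch-c
      open Branched (proj₂ branch-c) public
    sym₂ = +-symmetric (+-symmetric sym₁)
    same₂ : ∀ {w} → w ≢ v → w ≢ y → w ≢ b → w ≢ z → w ≢ c → Same X X₂.Y w
    same₂ w≢v w≢y w≢b w≢z w≢c = same-trans (same₁ w≢v w≢y w≢b) (X₂.same-w w≢v (w≢z ∷ w≢c ∷ []))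
    same-x : Same X X₂.Y x
    same-x = same₂ x≢v x≢y x≢b x≢z x≢c

-- `smaller` is the induction hypothesis; the edge at a vertex of `W` certifies that the deletion
-- removes something.
module Reduction {n : ℕ} (S : Fin n → Fin n → Bool) (S-sym : ∀ {x y} → T (S x y) → T (S y x))
  (deg≤3 : ∀ v → count (S v) ≤ 3)
  (smaller : ∀ {W w y} → w ∈ W → T (S w y) → Coloring (λ x y → T (delete S W x y))) where

  open DecMembership (Fin._≟_ {n}) using (_∈?_)

  E : Rel (Fin n) 0ℓ
  E x y = T (S x y)

  E∖ : List (Fin n) → Rel (Fin n) 0ℓ
  E∖ W x y = T (delete S W x y)

  Nbrs : Fin n → List (Fin n) → Set
  Nbrs v xs = ∀ {y} → T (S v y) → y ∈ xs

  -- A smaller neighbourhood is padded with repetitions of `w`, so degrees one to three are treated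
  -- alike.
  others : ∀ {x w} → T (S x w) → ∃₂ λ a b → Nbrs x (w ∷ a ∷ b ∷ [])
  others {x} {w} e with any? (λ a → T? (S x a) ×-dec ¬? (a ∈? w ∷ []))
  ... | no none = w , w , λ {y} r → widen (decidable-stable (y ∈? w ∷ []) λ y∉ → none (y , r , y∉))
    where
    widen : ∀ {y} → y ∈ w ∷ [] → y ∈ w ∷ w ∷ w ∷ []
    widen at0 = at0
  ... | yes (a , ea , a∉) with any? (λ b → T? (S x b) ×-dec ¬? (b ∈? a ∷ w ∷ []))
  ...   | no none = a , w , λ {y} r → widen (decidable-stable (y ∈? a ∷ w ∷ []) λ y∉ → none (y , r , y∉))
    where
    widen : ∀ {y} → y ∈ a ∷ w ∷ [] → y ∈ w ∷ a ∷ w ∷ []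
    widen at0 = at1
    widen at1 = at0
  ...   | yes (b , eb , b∉) = a , b , λ r → widen (count-cover (S x)
            (¬Any⇒All¬ _ b∉ ∷ ¬Any⇒All¬ _ a∉ ∷ [] ∷ []) (eb ∷ ea ∷ e ∷ []) (deg≤3 x) r)
    where
    widen : ∀ {y} → y ∈ b ∷ a ∷ w ∷ [] → y ∈ w ∷ a ∷ b ∷ []
    widen at0 = at2
    widen at1 = at1
    widen at2 = at0

  isolated : ∀ {W w} → w ∈ W → Isolated (E∖ W) w
  isolated {W} w∈ r = proj₁ (proj₂ (delete⁻ {S = S} {W} r)) w∈

  free-boundary : ∀ {W x w} (X : Coloring (E∖ W)) → w ∈ W → T (S w x) →
                  ∃ λ α → α ∈⁰ pal X x × Free X x α
  free-boundary {W} {x} {w} X w∈ e with others (S-sym e)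
  ... | a , b , nbrs = free-color (delete-sym S S-sym W) X λ r → let s , _ , y∉ = delete⁻ {S = S} {W} r in drop y∉ (nbrs s)
    where
    drop : ∀ {y} → y ∉ W → y ∈ w ∷ a ∷ b ∷ [] → y ∈ a ∷ b ∷ []
    drop y∉ at0 = contradiction w∈ y∉
    drop y∉ (there p) = p

  glue : ∀ {W} {R : Rel (Fin n) 0ℓ} → Symmetric R → Coloring R → (∀ {x y} → E∖ W x y → R x y) →
         All (λ w → ∀ {y} → T (S w y) → R w y) W → Coloring (λ x y → T (S x y))
  glue {W} {R} R-sym Y old-R new-R = restrict grow Y
    where
    grow : ∀ {x y} → T (S x y) → R x y
    grow {x} {y} e with x ∈? W | y ∈? W
    ... | yes x∈ | _      = All.lookup new-R x∈ e
    ... | no _   | yes y∈ = R-sym (All.lookup new-R y∈ (S-sym e))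
    ... | no x∉  | no y∉  = old-R (delete⁺ {S = S} {W} e x∉ y∉)

  reduce-leaf : ∀ {v u} → u ≢ v → E v u → Nbrs v (u ∷ []) → Coloring E
  reduce-leaf {v} {u} u≢v vu v-nbrs
    with X ← smaller {v ∷ []} at0 vu
    with α , α∈ , free ← free-boundary X at0 vu
    = glue (+-symmetric sym₀) (Attached.Y (attach sym₀ X u≢v (isolated at0) α∈ α∈P X-P free)) old
        ((λ r → case-v (v-nbrs r)) ∷ [])
    where
    sym₀ = delete-sym S S-sym (v ∷ [])
    open Leaf (leaf-palette α∈)
    case-v : ∀ {y} → y ∈ u ∷ [] → (_ +[ u - v ]) v y
    case-v at0 = ←e

  reduce-path : ∀ {x a b c y} → Unique (x ∷ a ∷ b ∷ c ∷ y ∷ []) → E a x → E c y →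
                Nbrs a (x ∷ b ∷ []) → Nbrs b (a ∷ c ∷ []) → Nbrs c (b ∷ y ∷ []) → Coloring E
  reduce-path {x} {a} {b} {c} {y} u ax cy a-nbrs b-nbrs c-nbrs =
    solve (smaller {W} at0 ax)
    where
    W = a ∷ b ∷ c ∷ []
    R₀ R⁺ : Rel (Fin n) 0ℓ
    R₀ = E∖ W
    R⁺ = R₀ +[ y - c ] +[ x - a ] +[ a - b ] +[ b - c ]
    case-a : ∀ {z} → z ∈ x ∷ b ∷ [] → R⁺ a z
    case-a at0 = old (old ←e)
    case-a at1 = old →e
    case-b : ∀ {z} → z ∈ a ∷ c ∷ [] → R⁺ b z
    case-b at0 = old ←e
    case-b at1 = →e
    case-c : ∀ {z} → z ∈ b ∷ y ∷ [] → R⁺ c z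
    case-c at0 = ←e
    case-c at1 = old (old (old ←e))
    finish : Coloring R⁺ → Coloring E
    finish Y = glue (+-symmetric (+-symmetric (+-symmetric (+-symmetric (delete-sym S S-sym W))))) Y (old ∘ old ∘ old ∘ old)
      ((λ r → case-a (a-nbrs r)) ∷ (λ r → case-b (b-nbrs r)) ∷ (λ r → case-c (c-nbrs r)) ∷ [])
    solve : Coloring R₀ → Coloring E
    solve X =
      let α , α∈ , free-x = free-boundary {W} X at0 ax
          γ , γ∈ , free-y = free-boundary {W} X at2 cy
      in finish (extend-path (delete-sym S S-sym W) X u (isolated {W} at0) (isolated {W} at1) (isolated {W} at2)
           α∈ free-x γ∈ free-y (centre₂₂ α nothing γ∈))

  reduce₂₂ : ∀ {x a′ a v b b′ y u} → Unique (x ∷ a′ ∷ a ∷ v ∷ b ∷ b′ ∷ y ∷ []) → All (u ≢_) (x ∷ a′ ∷ a ∷ v ∷ b ∷ b′ ∷ y ∷ []) →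
             E a′ x → E b′ y → E v u →
             Nbrs a′ (x ∷ a ∷ []) → Nbrs a (a′ ∷ v ∷ []) → Nbrs b′ (y ∷ b ∷ []) → Nbrs b (b′ ∷ v ∷ []) →
             Nbrs v (a ∷ b ∷ u ∷ []) → Coloring E
  reduce₂₂ {x} {a′} {a} {v} {b} {b′} {y} {u} uniq u≢ a′x b′y vu a′-nbrs a-nbrs b′-nbrs b-nbrs v-nbrs =
    solve (smaller {W} at0 vu)
    where
    W = v ∷ a ∷ a′ ∷ b ∷ b′ ∷ []
    in-b′ : b′ ∈ W
    in-b′ = there at3
    R₀ R⁺ : Rel (Fin n) 0ℓ
    R₀ = E∖ W
    R⁺ = R₀ +[ u - v ] +[ x - a′ ] +[ a′ - a ] +[ a - v ] +[ y - b′ ] +[ b′ - b ] +[ b - v ]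
    case-v : ∀ {z} → z ∈ a ∷ b ∷ u ∷ [] → R⁺ v z
    case-v at0 = old (old (old ←e))
    case-v at1 = ←e
    case-v at2 = old (old (old (old (old (old ←e)))))
    case-a : ∀ {z} → z ∈ a′ ∷ v ∷ [] → R⁺ a z
    case-a at0 = old (old (old (old ←e)))
    case-a at1 = old (old (old →e))
    case-a′ : ∀ {z} → z ∈ x ∷ a ∷ [] → R⁺ a′ z
    case-a′ at0 = old (old (old (old (old ←e))))
    case-a′ at1 = old (old (old (old →e)))
    case-b : ∀ {z} → z ∈ b′ ∷ v ∷ [] → R⁺ b z
    case-b at0 = old ←e
    case-b at1 = →e
    case-b′ : ∀ {z} → z ∈ y ∷ b ∷ [] → R⁺ b′ z
    case-b′ at0 = old (old ←e)
    case-b′ at1 = old →e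
    finish : Coloring R⁺ → Coloring E
    finish Y = glue (+-symmetric (+-symmetric (+-symmetric (+-symmetric (+-symmetric (+-symmetric (+-symmetric (delete-sym S S-sym W))))))))
      Y (old ∘ old ∘ old ∘ old ∘ old ∘ old ∘ old)
      ((λ r → case-v (v-nbrs r)) ∷ (λ r → case-a (a-nbrs r)) ∷ (λ r → case-a′ (a′-nbrs r))
      ∷ (λ r → case-b (b-nbrs r)) ∷ (λ r → case-b′ (b′-nbrs r)) ∷ [])
    solve : Coloring R₀ → Coloring E
    solve X =
      let α , α∈ , free-x = free-boundary {W} X at2 a′x
          β , β∈ , free-y = free-boundary {W} X in-b′ b′y
          γ , γ∈ , free-u = free-boundary {W} X at0 vu
      in finish (extend₂₂ (delete-sym S S-sym W) X uniq u≢
           (isolated {W} at2) (isolated {W} at1) (isolated {W} at0) (isolated {W} at3) (isolated {W} in-b′)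
           α∈ free-x β∈ free-y γ∈ free-u (centre₂₂ α β γ∈))

  reduce₁₁₂ : ∀ {x a′ a v b y c z} → Unique (x ∷ a′ ∷ a ∷ v ∷ b ∷ y ∷ []) → Unique (x ∷ a′ ∷ a ∷ v ∷ c ∷ z ∷ []) →
              Unique (y ∷ b ∷ v ∷ c ∷ z ∷ []) → E a′ x → E b y → E c z →
              Nbrs a′ (x ∷ a ∷ []) → Nbrs a (a′ ∷ v ∷ []) → Nbrs b (y ∷ v ∷ []) → Nbrs c (z ∷ v ∷ []) →
              Nbrs v (a ∷ b ∷ c ∷ []) → Coloring E
  reduce₁₁₂ {x} {a′} {a} {v} {b} {y} {c} {z} u u′ u″ a′x by cz a′-nbrs a-nbrs b-nbrs c-nbrs v-nbrs =
    solve (smaller {W} at2 a′x)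
    where
    W = v ∷ a ∷ a′ ∷ b ∷ c ∷ []
    in-c : c ∈ W
    in-c = there at3
    R₀ R⁺ : Rel (Fin n) 0ℓ
    R₀ = E∖ W
    R⁺ = R₀ +[ y - b ] +[ b - v ] +[ z - c ] +[ c - v ] +[ x - a′ ] +[ a′ - a ] +[ a - v ]
    case-v : ∀ {t} → t ∈ a ∷ b ∷ c ∷ [] → R⁺ v t
    case-v at0 = ←e
    case-v at1 = old (old (old (old (old ←e))))
    case-v at2 = old (old (old ←e))
    case-a : ∀ {t} → t ∈ a′ ∷ v ∷ [] → R⁺ a t
    case-a at0 = old ←e
    case-a at1 = →e
    case-a′ : ∀ {t} → t ∈ x ∷ a ∷ [] → R⁺ a′ t
    case-a′ at0 = old (old ←e)
    case-a′ at1 = old →e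
    case-b : ∀ {t} → t ∈ y ∷ v ∷ [] → R⁺ b t
    case-b at0 = old (old (old (old (old (old ←e)))))
    case-b at1 = old (old (old (old (old →e))))
    case-c : ∀ {t} → t ∈ z ∷ v ∷ [] → R⁺ c t
    case-c at0 = old (old (old (old ←e)))
    case-c at1 = old (old (old →e))
    finish : Coloring R⁺ → Coloring E
    finish Y = glue (+-symmetric (+-symmetric (+-symmetric (+-symmetric (+-symmetric (+-symmetric (+-symmetric (delete-sym S S-sym W))))))))
      Y (old ∘ old ∘ old ∘ old ∘ old ∘ old ∘ old)
      ((λ r → case-v (v-nbrs r)) ∷ (λ r → case-a (a-nbrs r)) ∷ (λ r → case-a′ (a′-nbrs r))
      ∷ (λ r → case-b (b-nbrs r)) ∷ (λ r → case-c (c-nbrs r)) ∷ [])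
    solve : Coloring R₀ → Coloring E
    solve X =
      let γ , γ∈ , free-x = free-boundary {W} X at2 a′x
          α , α∈ , free-y = free-boundary {W} X at3 by
          β , β∈ , free-z = free-boundary {W} X in-c cz
      in finish (extend₁₁₂ (delete-sym S S-sym W) X u u′ u″
           (isolated {W} at2) (isolated {W} at1) (isolated {W} at0) (isolated {W} at3) (isolated {W} in-c)
           α∈ free-y β∈ free-z γ∈ free-x (centre₁₁₂ γ α∈ β∈))

-- Girth

-- Past the end of the list the default value d is returned.
at : A → List A → ℕ → A
at d []       _       = d
at d (x ∷ _)  zero    = x
at d (_ ∷ xs) (suc i) = at d xs i

at-∈ : ∀ {d : A} xs {i} → i ℕ.< length xs → at d xs i ∈ xs
at-∈ (x ∷ xs) {zero}  _         = here refl
at-∈ (x ∷ xs) {suc i} (s≤s i<) = there (at-∈ xs i<)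

∈-at : ∀ {d x : A} {xs} → x ∈ xs → ∃ λ i → i ℕ.< length xs × at d xs i ≡ x
∈-at (here refl) = 0 , z<s , refl
∈-at (there p)   = let i , i< , eq = ∈-at p in suc i , s<s i< , eq

at-injective : ∀ {d : A} {xs} → Unique xs → ∀ {i j} → i ℕ.< length xs → j ℕ.< length xs →
               at d xs i ≡ at d xs j → i ≡ j
at-injective (_ ∷ _) {zero}  {zero}  _ _ _ = refl
at-injective {xs = _ ∷ xs} (x∉ ∷ _) {zero}  {suc j} _ (s≤s j<) eq = contradiction eq (All.lookup x∉ (at-∈ xs j<))
at-injective {xs = _ ∷ xs} (x∉ ∷ _) {suc i} {zero} (s≤s i<) _ eq = contradiction (sym eq) (All.lookup x∉ (at-∈ xs i<))
at-injective (_ ∷ u) {suc i} {suc j} (s≤s i<) (s≤s j<) eq = cong suc (at-injective u i< j< eq)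

module Trails (G : Graph) where
  open Graph G

  data Trail : List Vertex → Set where
    [_]  : ∀ v → Trail (v ∷ [])
    last : ∀ {u v} → Adj u v → Trail (u ∷ v ∷ [])
    cons : ∀ {u v w ws} → Adj u v → u ≢ w → Trail (v ∷ w ∷ ws) → Trail (u ∷ v ∷ w ∷ ws)

  trail-step : ∀ {d xs} → Trail xs → ∀ {i} → suc i ℕ.< length xs → Adj (at d xs i) (at d xs (suc i))
  trail-step [ _ ] {zero} (s≤s ())
  trail-step [ _ ] {suc i} (s≤s ())
  trail-step (last e) {zero} _ = e
  trail-step (last e) {suc i} (s≤s (s≤s ()))
  trail-step (cons e _ _) {zero} _ = e
  trail-step (cons _ _ t) {suc i} (s≤s i<) = trail-step t i<

  -- The cycle is the part of the trail up to the return to `x`. A return after one step would be a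
  -- loop, and after two steps a reversal.
  closed-trail : ∀ {x xs} → Trail (x ∷ xs) → Unique xs → x ∈ xs → ∃ λ (c : Cycle) → Cycle.cycleLength c ≤ length xs
  closed-trail {x} {xs} t u x∈ with ∈-at {d = x} x∈
  ... | zero , k< , eq = contradiction (subst (Adj x) eq (trail-step {d = x} t (s<s k<))) (adj-irrefl x)
  closed-trail (cons _ u≢w _) _ _ | suc zero , _ , eq = contradiction (sym eq) u≢w
  closed-trail (last _) _ _ | suc zero , s≤s () , _
  closed-trail [ _ ] _ _ | suc zero , () , _
  closed-trail {x} {xs} t u _ | suc (suc e) , k< , eq = record
    { extra = e
    ; vertex = w ∘ toℕ
    ; distinct = λ {i} {j} eq → toℕ-injective (w-injective (toℕ<n i) (toℕ<n j) eq)
    ; step = λ i → subst (λ k → Adj (w k) (w (suc (toℕ i)))) (sym (toℕ-inject₁ i))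
        (trail-step t (s<s (ℕ.<-trans (toℕ<n i) k<)))
    ; close = subst₂ Adj (sym (cong w (toℕ-fromℕ (2 ℕ.+ e)))) eq (trail-step t (s<s k<))
    } , k<
    where
    w : ℕ → Vertex
    w = at x (x ∷ xs)
    repeat : ∀ {j} → suc j ℕ.< 3 ℕ.+ e → x ≢ at x xs j
    repeat (s≤s j<) x≡ = ℕ.<⇒≢ j< (at-injective u (ℕ.<-trans j< k<) k< (trans (sym x≡) (sym eq)))
    w-injective : ∀ {i j} → i ℕ.< 3 ℕ.+ e → j ℕ.< 3 ℕ.+ e → w i ≡ w j → i ≡ j
    w-injective {zero}  {zero}  _ _ _ = refl
    w-injective {zero}  {suc j} _ j< eq = contradiction eq (repeat j<)
    w-injective {suc i} {zero}  i< _ eq = contradiction (sym eq) (repeat i<)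
    w-injective {suc i} {suc j} (s≤s i<) (s≤s j<) eq = cong suc (at-injective u (ℕ.<-trans i< k<) (ℕ.<-trans j< k<) eq)

  -- If the first vertex recurs among the others, which are distinct by induction, `closed-trail`
  -- gives a cycle shorter than the number of vertices of the trail, hence shorter than `g`.
  trail-unique : ∀ {g} → GirthAtLeast g G → ∀ {xs} → Trail xs → length xs ≤ g → Unique xs
  trail-unique girth [ v ] _ = [] ∷ []
  trail-unique girth (last {u} {v} e) (s≤s l≤) = ((λ { refl → adj-irrefl u e }) ∷ []) ∷ [] ∷ []
  trail-unique girth (cons {u} {v} {w} {ws} e u≢w t′) l≤ =
    ¬Any⇒All¬ _ (λ u∈ → let c , c≤ = closed-trail (cons e u≢w t′) uniq u∈ in
      ℕ.<⇒≱ (ℕ.≤-<-trans c≤ l≤) (girth c)) ∷ uniq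
    where
    uniq : Unique (v ∷ w ∷ ws)
    uniq = trail-unique girth t′ (ℕ.<⇒≤ l≤)

-- Discharging

module Discharge {n : ℕ} (S : Fin n → Fin n → Bool) (S-sym : ∀ {x y} → T (S x y) → T (S y x))
  (deg≤3 : ∀ v → count (S v) ≤ 3) where

  δ : Fin n → ℕ
  δ v = count (S v)

  E : Fin n → Fin n → Set
  E u v = T (S u v)

  -- The thread leaving `v` through `a` has at least one, respectively at least two, 2-vertices;
  -- `Long` includes `Short`.
  Short Long : Fin n → Fin n → Set
  Short v a = E v a × δ a ≡ 2
  Long v a  = Short v a × ∃ λ a′ → E a a′ × a′ ≢ v × δ a′ ≡ 2

  -- The patterns are lower bounds on thread lengths: the third edge of a `Star₂₂` may begin a
  -- thread of any length.
  Path₃ Star₂₂ Star₁₁₂ : Set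
  Path₃   = ∃ λ a → ∃ λ b → ∃ λ c → E a b × E b c × a ≢ c × δ a ≡ 2 × δ b ≡ 2 × δ c ≡ 2
  Star₂₂  = ∃ λ v → ∃ λ a → ∃ λ b → δ v ≡ 3 × a ≢ b × Long v a × Long v b
  Star₁₁₂ = ∃ λ v → ∃ λ a → ∃ λ b → ∃ λ c → δ v ≡ 3 × a ≢ b × a ≢ c × b ≢ c × Long v a × Short v b × Short v c

  short? : ∀ v a → Dec (Short v a)
  short? v a = T? (S v a) ×-dec (δ a ℕ.≟ 2)

  long? : ∀ v a → Dec (Long v a)
  long? v a = short? v a ×-dec any? λ a′ → T? (S a a′) ×-dec ¬? (a′ Fin.≟ v) ×-dec (δ a′ ℕ.≟ 2)

  path₃? : Dec Path₃
  path₃? = any? λ a → any? λ b → any? λ c → T? (S a b) ×-dec T? (S b c) ×-dec ¬? (a Fin.≟ c) ×-dec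
    (δ a ℕ.≟ 2) ×-dec (δ b ℕ.≟ 2) ×-dec (δ c ℕ.≟ 2)

  star₂₂? : Dec Star₂₂
  star₂₂? = any? λ v → any? λ a → any? λ b → (δ v ℕ.≟ 3) ×-dec ¬? (a Fin.≟ b) ×-dec long? v a ×-dec long? v b

  star₁₁₂? : Dec Star₁₁₂
  star₁₁₂? = any? λ v → any? λ a → any? λ b → any? λ c → (δ v ℕ.≟ 3) ×-dec ¬? (a Fin.≟ b) ×-dec ¬? (a Fin.≟ c) ×-dec
    ¬? (b Fin.≟ c) ×-dec long? v a ×-dec short? v b ×-dec short? v c

  second-nbr : ∀ {v w} → δ v ≡ 2 → E v w → ∃ λ z → E v z × z ≢ w × (∀ {y} → E v y → y ∈ w ∷ z ∷ [])
  second-nbr {v} {w} δ≡2 vw with count-fresh (S v) (w ∷ []) (ℕ.≤-reflexive (sym δ≡2))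
  ... | z , vz , z∉ = z , vz , (λ { refl → z∉ (here refl) }) ,
    count-cover (S v) (((λ { refl → z∉ (here refl) }) ∷ []) ∷ [] ∷ []) (vw ∷ vz ∷ []) (ℕ.≤-reflexive δ≡2)

  module _ (no-leaf : ∀ v → δ v ≢ 1) (no-path : ¬ Path₃) (no₂₂ : ¬ Star₂₂) (no₁₁₂ : ¬ Star₁₁₂) where

    data Degree (v : Fin n) : Set where
      is0 : δ v ≡ 0 → Degree v
      is2 : δ v ≡ 2 → Degree v
      is3 : δ v ≡ 3 → Degree v

    degree? : ∀ v → Degree v
    degree? v = cases _ refl (deg≤3 v)
      where
      cases : ∀ k → δ v ≡ k → k ≤ 3 → Degree v
      cases 0 eq _ = is0 eq
      cases 1 eq _ = contradiction eq (no-leaf v)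
      cases 2 eq _ = is2 eq
      cases 3 eq _ = is3 eq
      cases (suc (suc (suc (suc _)))) _ (s≤s (s≤s (s≤s ())))

    δ≢0 : ∀ {v w} → E v w → δ v ≢ 0
    δ≢0 {v} {w} e eq = contradiction (unique⇒length≤count (S v) ([] ∷ []) (e ∷ [])) (ℕ.<⇒≱ (s≤s (ℕ.≤-reflexive eq)))

    -- A 3-vertex z gives one unit of charge to a 2-vertex for each pair in
    -- short z, and one for each pair in long z: the 2-vertices on the thread
    -- leaving z through a, which are at most two. Each of the two edges at a
    -- 2-vertex brings in one unit.
    demand short long : Fin n → Fin n → Bool
    demand v w = isYes (T? (S v w) ×-dec (δ v ℕ.≟ 2))
    short z a  = isYes ((δ z ℕ.≟ 3) ×-dec short? z a)
    long z a   = isYes ((δ z ℕ.≟ 3) ×-dec long? z a)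

    Demand Supply : Set
    Demand = Σ (Fin n) λ v → Σ (Fin n) (T ∘ demand v)
    Supply = Σ (Fin n) λ z → Σ (Fin n) (T ∘ short z) ⊎ Σ (Fin n) (T ∘ long z)

    -- The 3-vertex that pays `v` across `w` is `w` itself or the vertex after it, since three
    -- 2-vertices in a row form a `Path₃`.
    data Source (v w : Fin n) : Set where
      near : δ w ≡ 3 → Source v w
      far  : ∀ z → E w z → z ≢ v → δ w ≡ 2 → δ z ≡ 3 → Source v w

    source : ∀ {v w} → E v w → δ v ≡ 2 → Source v w
    source {v} {w} vw δv with degree? w
    ... | is0 δw = contradiction δw (δ≢0 (S-sym vw))
    ... | is3 δw = near δw
    ... | is2 δw with second-nbr δw (S-sym vw)
    ...   | z , wz , z≢v , _ with degree? z
    ...     | is0 δz = contradiction δz (δ≢0 (S-sym wz))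
    ...     | is2 δz = contradiction (v , w , z , vw , wz , ≢-sym z≢v , δv , δw , δz) no-path
    ...     | is3 δz = far z wz z≢v δw δz

    supplyFrom : ∀ {v w} → E v w → δ v ≡ 2 → Source v w → Supply
    supplyFrom {v} {w} vw δv (near δw) = w , inj₁ (v , fromWitness (δw , S-sym vw , δv))
    supplyFrom {v} {w} vw δv (far z wz z≢v δw δz) =
      z , inj₂ (w , fromWitness (δz , (S-sym wz , δw) , v , S-sym vw , ≢-sym z≢v , δv))

    supply : Demand → Supply
    supply (v , w , p) = let vw , δv = toWitness p in supplyFrom vw δv (source vw δv)

    key : Supply → Fin n × Fin n × Bool
    key (z , inj₁ (a , _)) = z , a , false
    key (z , inj₂ (a , _)) = z , a , true

    supplyFrom-injective : ∀ {v w v′ w′} (vw : E v w) (δv : δ v ≡ 2) s (vw′ : E v′ w′) (δv′ : δ v′ ≡ 2) s′ →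
                           key (supplyFrom vw δv s) ≡ key (supplyFrom vw′ δv′ s′) → v ≡ v′ × w ≡ w′
    supplyFrom-injective vw δv (near _) vw′ δv′ (near _) refl = refl , refl
    -- The 2-vertex `w` has only one neighbour besides `z`, so `v` and `v′` agree.
    supplyFrom-injective {v} {w} {v′} vw δv (far z wz z≢v δw δz) vw′ δv′ (far .z wz′ z≢v′ δw′ δz′) refl
      with second-nbr δw wz
    ... | u , _ , _ , nbrs with nbrs (S-sym vw) | nbrs (S-sym vw′)
    ...   | here refl | _ = contradiction refl z≢v
    ...   | _ | here refl = contradiction refl z≢v′
    ...   | there (here refl) | there (here refl) = refl , refl
    supplyFrom-injective vw δv (near _) vw′ δv′ (far _ _ _ _ _) ()
    supplyFrom-injective vw δv (far _ _ _ _ _) vw′ δv′ (near _) ()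

    demand≤supply : sum (λ v → count (demand v)) ≤ sum (λ z → count (short z) + count (long z))
    demand≤supply = size-mono (size-Σ (size-count ∘ demand)) (size-Σ (λ z → size-⊎ (size-count (short z)) (size-count (long z))))
      supply λ { {v , w , p} {v′ , w′ , p′} eq →
        let vw , δv = toWitness p ; vw′ , δv′ = toWitness p′
            v≡ , w≡ = supplyFrom-injective vw δv (source vw δv) vw′ δv′ (source vw′ δv′) (cong key eq)
        in ΣΣ-T-≡ v≡ w≡ }

    short⁻ : ∀ {z a} → T (short z a) → δ z ≡ 3 × Short z a
    short⁻ = toWitness

    long⁻ : ∀ {z a} → T (long z a) → δ z ≡ 3 × Long z a
    long⁻ = toWitness

    -- Two long threads form a `Star₂₂`. One long thread beside three short pairs forms a `Star₁₁₂`;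
    -- the long thread is itself among the short pairs, so the other two are chosen different from
    -- it.
    supply≤3 : ∀ z → δ z ≡ 3 → count (short z) + count (long z) ≤ 3
    supply≤3 z δz = bound _ _ refl refl short≤3
      where
      short≤3 : count (short z) ≤ 3
      short≤3 = ℕ.≤-trans (count-mono {P = short z} {S z} (proj₁ ∘ proj₂ ∘ short⁻)) (deg≤3 z)
      bound : ∀ s l → count (short z) ≡ s → count (long z) ≡ l → s ≤ 3 → s + l ≤ 3
      bound s 0 _ _ s≤3 = ℕ.≤-trans (ℕ.≤-reflexive (ℕ.+-identityʳ s)) s≤3
      bound 0 1 _ _ _ = s≤s z≤n
      bound 1 1 _ _ _ = s≤s (s≤s z≤n)
      bound 2 1 _ _ _ = s≤s (s≤s (s≤s z≤n))
      bound (suc (suc (suc s))) 1 s≡ l≡ _ =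
        contradiction (choose-a (count-fresh (long z) [] (subst (0 ℕ.<_) (sym l≡) (s≤s z≤n)))) no₁₁₂
        where
        star : ∀ {a b} → T (long z a) → T (short z b) → b ∉ a ∷ [] → (∃ λ c → T (short z c) × c ∉ a ∷ b ∷ []) → Star₁₁₂
        star {a} {b} la sb b∉ (c , sc , c∉) = z , a , b , c , δz , b∉ ∘ here ∘ sym , c∉ ∘ here ∘ sym , c∉ ∘ there ∘ here ∘ sym ,
          proj₂ (long⁻ la) , proj₂ (short⁻ sb) , proj₂ (short⁻ sc)
        choose-b : ∀ {a} → T (long z a) → (∃ λ b → T (short z b) × b ∉ a ∷ []) → Star₁₁₂
        choose-b {a} la (b , sb , b∉) = star la sb b∉ (count-fresh (short z) (a ∷ b ∷ []) (subst (2 ℕ.<_) (sym s≡) (s≤s (s≤s (s≤s z≤n)))))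
        choose-a : (∃ λ a → T (long z a) × a ∉ []) → Star₁₁₂
        choose-a (a , la , _) = choose-b la (count-fresh (short z) (a ∷ []) (subst (1 ℕ.<_) (sym s≡) (s≤s (s≤s z≤n))))
      bound _ (suc (suc l)) _ l≡ _ =
        contradiction (choose-a (count-fresh (long z) [] (subst (0 ℕ.<_) (sym l≡) (s≤s z≤n)))) no₂₂
        where
        choose-b : ∀ {a} → T (long z a) → (∃ λ b → T (long z b) × b ∉ a ∷ []) → Star₂₂
        choose-b {a} la (b , lb , b∉) = z , a , b , δz , b∉ ∘ here ∘ sym , proj₂ (long⁻ la) , proj₂ (long⁻ lb)
        choose-a : (∃ λ a → T (long z a) × a ∉ []) → Star₂₂
        choose-a (a , la , _) = choose-b la (count-fresh (long z) (a ∷ []) (subst (1 ℕ.<_) (sym l≡) (s≤s (s≤s z≤n))))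

    no-supply : ∀ {v} → δ v ≢ 3 → count (short v) + count (long v) ≡ 0
    no-supply {v} δ≢3 = cong₂ _+_ (count-none {P = short v} (δ≢3 ∘ proj₁ ∘ short⁻)) (count-none {P = long v} (δ≢3 ∘ proj₁ ∘ long⁻))

    support : Fin n → Bool
    support v = isYes (1 ℕ.≤? δ v)

    weight : ∀ {v k} → δ v ≡ k → 12 * indicator (support v) ≡ 12 * indicator (isYes (1 ℕ.≤? k))
    weight = cong (λ k → 12 * indicator (isYes (1 ℕ.≤? k)))

    -- With charge `5 * δ v` against a need of 12, a 2-vertex lacks the two units that its edges
    -- demand, and a 3-vertex can give away three.
    balance : ∀ {v} → Degree v → 12 * indicator (support v) + (count (short v) + count (long v)) ≤ 5 * δ v + count (demand v)
    balance {v} (is0 δv) = ℕ.≤-trans (ℕ.≤-reflexive (cong₂ _+_ (weight δv) (no-supply λ eq → contradiction (trans (sym δv) eq) λ ()))) z≤n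
    balance {v} (is2 δv) = begin
      12 * indicator (support v) + (count (short v) + count (long v))
                                  ≡⟨ cong₂ _+_ (weight δv) (no-supply λ eq → contradiction (trans (sym δv) eq) λ ()) ⟩
      5 * 2 + 2                   ≡⟨ cong₂ _+_ (cong (5 *_) δv) δv ⟨
      5 * δ v + δ v               ≤⟨ ℕ.+-monoʳ-≤ (5 * δ v) (count-mono {P = S v} {demand v} (λ e → fromWitness (e , δv))) ⟩
      5 * δ v + count (demand v)  ∎
      where open ℕ.≤-Reasoning
    balance {v} (is3 δv) = begin
      12 * indicator (support v) + (count (short v) + count (long v))
                                  ≤⟨ ℕ.+-mono-≤ (ℕ.≤-reflexive (weight δv)) (supply≤3 v δv) ⟩
      5 * 3                       ≡⟨ cong (5 *_) δv ⟨
      5 * δ v                     ≤⟨ ℕ.m≤m+n _ _ ⟩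
      5 * δ v + count (demand v)  ∎
      where open ℕ.≤-Reasoning

    discharge : 12 * count support ≤ 5 * sum δ
    discharge = ℕ.+-cancelʳ-≤ total _ _ (begin
      12 * count support + total             ≡⟨ cong (_+ total) (trans (cong (12 *_) (count≡sum support)) (*-distribˡ-sum 12 (indicator ∘ support))) ⟩
      sum (λ v → 12 * indicator (support v)) + total
        ≡⟨ ∑-distrib-+ (λ v → 12 * indicator (support v)) (λ v → count (short v) + count (long v)) ⟨
      sum (λ v → 12 * indicator (support v) + (count (short v) + count (long v)))
        ≤⟨ sum-mono (balance ∘ degree?) ⟩
      sum (λ v → 5 * δ v + count (demand v)) ≡⟨ ∑-distrib-+ (λ v → 5 * δ v) (λ v → count (demand v)) ⟩
      sum (λ v → 5 * δ v) + sum (λ v → count (demand v))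
        ≡⟨ cong (_+ sum (λ v → count (demand v))) (*-distribˡ-sum 5 δ) ⟨
      5 * sum δ + sum (λ v → count (demand v)) ≤⟨ ℕ.+-monoʳ-≤ (5 * sum δ) demand≤supply ⟩
      5 * sum δ + total                      ∎)
      where
      open ℕ.≤-Reasoning
      total : ℕ
      total = sum (λ z → count (short z) + count (long z))

-- Sparseness

-- Some power of a permutation of a finite set undoes it.
module _ {D : Set} {N : ℕ} (darts : Size D N) (π : D ↔ D) where

  private
    f : D → D
    f = Inverse.to π

    iter : ℕ → D → D
    iter zero    x = x
    iter (suc k) x = f (iter k x)

    iter-cancel : ∀ i {k x} → iter i x ≡ iter (i + k) x → x ≡ iter k x
    iter-cancel zero    eq = eq
    iter-cancel (suc i) eq = iter-cancel i (↔-injective π eq)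

    reach : ∀ k x → Star (Steps f) (f x) (iter (suc k) x)
    reach zero    x = ε
    reach (suc k) x = reach k x ◅◅ (refl ◅ ε)

    undo : ∀ x → Star (Steps f) (f x) x
    undo x with pigeonhole (ℕ.n<1+n N) (λ i → Inverse.to darts (iter (toℕ i) x))
    ... | i , j , i<j , eq = subst (Star (Steps f) (f x)) (sym back) (reach gap x)
      where
      gap = toℕ j ∸ suc (toℕ i)
      j≡ : toℕ i + suc gap ≡ toℕ j
      j≡ = trans (ℕ.+-suc (toℕ i) gap) (ℕ.m+[n∸m]≡n i<j)
      back : x ≡ iter (suc gap) x
      back = iter-cancel (toℕ i) (trans (↔-injective darts eq) (cong (λ m → iter m x) (sym j≡)))

  -- A backward step is replaced by going forward round the rest of the cycle.
  orbit-forward : ∀ {x y} → EqClosure (Steps f) x y → Star (Steps f) x y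
  orbit-forward ε              = ε
  orbit-forward (fwd r ◅ w)    = r ◅ orbit-forward w
  orbit-forward (bwd refl ◅ w) = undo _ ◅◅ orbit-forward w

module _ (G : Graph) where
  open Graph G

  dart-≡ : {d e : Dart} → Dart.tail d ≡ Dart.tail e → Dart.head d ≡ Dart.head e → d ≡ e
  dart-≡ {d} {e} refl refl = cong (λ p → record { tail = Dart.tail d ; head = Dart.head d ; adjacent = p }) (T-irrelevant _ _)

  size-dart : Size Dart (sum λ u → count (adj u))
  size-dart = size-Σ (λ u → size-count (adj u)) ↔-∘ mk↔ₛ′
    (λ d → Dart.tail d , Dart.head d , Dart.adjacent d)
    (λ (u , v , p) → record { tail = u ; head = v ; adjacent = p })
    (λ _ → refl) (λ _ → refl)

module Sparse (G : Graph) (planar : Planar G) (girth : GirthAtLeast 12 G)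
  (S : Fin (Graph.order G) → Fin (Graph.order G) → Bool) (S-sym : ∀ {x y} → T (S x y) → T (S y x))
  (S⊆ : ∀ {x y} → T (S x y) → T (Graph.adj G x y))
  (go-on : ∀ {u v} → T (S u v) → ∃ λ w → T (S v w) × w ≢ u)
  {u₀ v₀ : Fin (Graph.order G)} (e₀ : T (S u₀ v₀)) where

  open Graph G
  open PlanarEmbedding planar
  open Trails G

  tl hd : Dart → Vertex
  tl = Dart.tail
  hd = Dart.head

  reverse² : ∀ d → reverse (reverse d) ≡ d
  reverse² d = dart-≡ G refl refl

  open CombinatorialMap (size-dart G) rotation reverse reverse²
    (λ d eq → adj-irrefl (tl d) (subst (Adj (tl d)) (cong tl eq) (Dart.adjacent d)))

  dartOf : ∀ {u v} → T (S u v) → Dart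
  dartOf {u} {v} e = record { tail = u ; head = v ; adjacent = S⊆ e }

  Sd : Dart → Bool
  Sd d = S (tl d) (hd d)

  Sd-closed : RevClosed Sd
  Sd-closed d with S (tl d) (hd d) in p | S (hd d) (tl d) in q
  ... | true  | true  = refl
  ... | false | false = refl
  ... | true  | false = contradiction (subst T q (S-sym (subst T (sym p) tt))) id
  ... | false | true  = contradiction (subst T p (S-sym (subst T (sym q) tt))) id

  δ : Vertex → ℕ
  δ v = count (S v)

  support : Vertex → Bool
  support v = isYes (1 ℕ.≤? δ v)

  support⁺ : ∀ {u v} → T (S u v) → T (support u)
  support⁺ {u} e = fromWitness (unique⇒length≤count (S u) ([] ∷ []) (e ∷ []))

  SDart : Set
  SDart = Σ Dart (T ∘ Sd)

  s-size : ∃ (Size SDart)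
  s-size = size-subtype (size-dart G) Sd

  s : ℕ
  s = proj₁ s-size

  sum-δ≤s : sum δ ≤ s
  sum-δ≤s = size-mono (size-Σ (size-count ∘ S)) (proj₂ s-size)
    (λ (u , v , e) → dartOf e , e)
    (λ { {u , v , e} {u′ , v′ , e′} eq → ΣΣ-T-≡ (cong (tl ∘ proj₁) eq) (cong (hd ∘ proj₁) eq) })

  joined : ∃ (ClassCount (Joined Sd))
  joined = joined-classes vertices edges faces components euler Sd

  regions : ∃ (ClassCount (Region Sd))
  regions = region-classes vertices edges faces components euler Sd

  c f : ℕ
  c = proj₁ joined
  f = proj₁ regions

  module J = Classes (proj₂ joined)
  module R = Classes (proj₂ regions)
  module VC = Classes vertices
  module CC = Classes components

  submap : s + 2 * (c + C) ≤ 2 * (V + f)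
  submap = euler-submap vertices edges faces components euler _ Sd-closed (ℕ.m≤n+m _ s) (proj₂ s-size) (proj₂ joined) (proj₂ regions)

  unsupported : ∀ {x y} → EqClosure (Joined Sd) x y → ¬ T (support (tl x)) → EqClosure (Steps rot) x y
  unsupported ε _ = ε
  unsupported {x} (fwd (inj₁ refl) ◅ w) x∉ = fwd refl ◅ unsupported w (x∉ ∘ subst (T ∘ support) (rotate-tail x))
  unsupported (_◅_ {j = y} (bwd (inj₁ refl)) w) x∉ = bwd refl ◅ unsupported w (x∉ ∘ subst (T ∘ support) (sym (rotate-tail y)))
  unsupported (fwd (inj₂ (p , refl)) ◅ w) x∉ = contradiction (support⁺ p) x∉
  unsupported (bwd (inj₂ (p , refl)) ◅ w) x∉ = contradiction (support⁺ (S-sym p)) x∉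

  -- A vertex that carries darts either has an edge of `S` or, by `unsupported`, is a whole class of
  -- `Joined Sd`.
  V≤ : V ≤ c + count support
  V≤ = size-mono (↔-id _) (size-⊎ (↔-id _) (size-count support)) (λ k → place (VC.rep k) (T? _))
    (λ {k} {l} eq → trans (sym (VC.class-rep k)) (trans (placed (VC.rep k) (VC.rep l) _ _ eq) (VC.class-rep l)))
    where
    place : ∀ x → Dec (T (support (tl x))) → Fin c ⊎ Σ Vertex (T ∘ support)
    place x (yes p) = inj₂ (tl x , p)
    place x (no _)  = inj₁ (J.class x)
    placed : ∀ x y p q → place x p ≡ place y q → VC.class x ≡ VC.class y
    placed x y (yes p) (yes q) eq = VC.~⇒≡ (cyclic x y (cong proj₁ (inj₂-injective eq)))
    placed x y (no ¬p) (no ¬q) eq = VC.~⇒≡ (unsupported (J.≡⇒~ (inj₁-injective eq)) ¬p)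
    placed x y (yes _) (no _) ()
    placed x y (no _) (yes _) ()

  -- `rot x` follows `reverse x` on a face, and outside `S` the darts `x` and `reverse x` share a
  -- region.
  cross : ∀ {x} → ¬ T (Sd x) → R.class x ≡ R.class (rot x)
  cross {x} x∉ = trans (R.step (inj₂ (x∉ , refl))) (R.step (inj₁ (cong rot (reverse² x))))

  record Next (a : Dart) : Set where
    field
      succ     : Dart
      in-S     : T (Sd succ)
      region   : R.class succ ≡ R.class a
      tail≡    : tl succ ≡ hd a
      no-turn  : succ ≢ reverse a

  -- Rotation passes over darts outside `S`, staying in the region by `cross`, and stops at the
  -- first dart of `S`. Should it meet `reverse a`, the next dart is `traceFace a`, again in the
  -- region of `a`. The walk to `g` bounds the search.
  turn : ∀ {a y g} → Star (Steps rot) y g → T (Sd g) → g ≢ reverse a → R.class y ≡ R.class a → tl y ≡ hd a → Next a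
  turn ε p g≢ r t = record { succ = _ ; in-S = p ; region = r ; tail≡ = t ; no-turn = g≢ }
  turn {a} {y} (refl ◅ w) p g≢ r t with T? (Sd y) | y ≟ reverse a
  ... | no y∉  | _        = turn w p g≢ (trans (sym (cross y∉)) r) (trans (rotate-tail y) t)
  ... | yes _  | yes refl = turn w p g≢ (sym (R.step (inj₁ refl))) (trans (rotate-tail y) t)
  ... | yes y∈ | no y≢    = record { succ = y ; in-S = y∈ ; region = r ; tail≡ = t ; no-turn = y≢ }

  depart : ∀ {a g} → Star (Steps rot) (reverse a) g → T (Sd g) → g ≢ reverse a → Next a
  depart ε          _ g≢ = contradiction refl g≢
  depart {a} (refl ◅ w) p g≢ = turn w p g≢ (sym (R.step (inj₁ refl))) (rotate-tail (reverse a))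

  next : ∀ {a} → T (Sd a) → Next a
  next {a} p = let w , e , w≢ = go-on p in
    depart (orbit-forward (size-dart G) rotation (cyclic (reverse a) (dartOf e) refl)) e (w≢ ∘ cong hd)

  module Walk (a : SDart) where

    walk : ℕ → SDart
    walk zero    = a
    walk (suc i) = let n = next {proj₁ (walk i)} (proj₂ (walk i)) in Next.succ n , Next.in-S n

    d : ℕ → Dart
    d = proj₁ ∘ walk

    tail-next : ∀ i → tl (d (suc i)) ≡ hd (d i)
    tail-next i = Next.tail≡ (next {proj₁ (walk i)} (proj₂ (walk i)))

    region : ∀ i → R.class (d i) ≡ R.class (proj₁ a)
    region zero    = refl
    region (suc i) = trans (Next.region (next {proj₁ (walk i)} (proj₂ (walk i)))) (region i)

    corner : ℕ → Vertex
    corner = tl ∘ d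

    segment : ℕ → ℕ → List Vertex
    segment k zero    = []
    segment k (suc m) = corner k ∷ segment (suc k) m

    side : ∀ i → Adj (corner i) (corner (suc i))
    side i = subst (Adj (corner i)) (sym (tail-next i)) (Dart.adjacent (d i))

    no-return : ∀ i → corner i ≢ corner (2 + i)
    no-return i eq = Next.no-turn (next {proj₁ (walk i)} (proj₂ (walk i)))
      (dart-≡ G (tail-next i) (trans (sym (tail-next (suc i))) (sym eq)))

    segment-trail : ∀ k m → Trail (segment k (suc m))
    segment-trail k zero          = [ _ ]
    segment-trail k (suc zero)    = last (side k)
    segment-trail k (suc (suc m)) = cons (side k) (no-return k) (segment-trail (suc k) (suc m))

    segment-length : ∀ k m → length (segment k m) ≡ m
    segment-length k zero    = refl
    segment-length k (suc m) = cong suc (segment-length (suc k) m)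

    at-segment : ∀ k {m i} → i ℕ.< m → at u₀ (segment k m) i ≡ corner (k + i)
    at-segment k {suc m} {zero}  _         = cong corner (sym (ℕ.+-identityʳ k))
    at-segment k {suc m} {suc i} (s≤s i<m) = trans (at-segment (suc k) i<m) (cong corner (sym (ℕ.+-suc k i)))

    -- The first twelve corners form a trail, so the girth makes them distinct, and equal darts have
    -- equal tails.
    walk-injective : ∀ (i j : Fin 12) → d (toℕ i) ≡ d (toℕ j) → i ≡ j
    walk-injective i j eq = toℕ-injective (at-injective {d = u₀} uniq (within i) (within j)
      (trans (at-segment 0 (toℕ<n i)) (trans (cong tl eq) (sym (at-segment 0 (toℕ<n j))))))
      where
      uniq : Unique (segment 0 12)
      uniq = trail-unique girth (segment-trail 0 11) (ℕ.≤-reflexive (segment-length 0 12))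
      within : ∀ (i : Fin 12) → toℕ i ℕ.< length (segment 0 12)
      within i = subst (toℕ i ℕ.<_) (sym (segment-length 0 12)) (toℕ<n i)

  -- As long as no dart of `S` is met, reversals stay in the region, and so do rotations by `cross`.
  empty-region : ∀ {x y} → (∀ d → T (Sd d) → R.class d ≢ R.class x) →
                 EqClosure (Steps rot ∪ Steps reverse) x y → R.class x ≡ R.class y
  empty-region none ε = refl
  empty-region {x} none (r ◅ w) = trans (move r) (empty-region (λ d p eq → none d p (trans eq (sym (move r)))) w)
    where
    x∉ : ∀ {z} → R.class z ≡ R.class x → ¬ T (Sd z)
    x∉ eq p = none _ p eq
    move : ∀ {z} → SymClosure (Steps rot ∪ Steps reverse) x z → R.class x ≡ R.class z
    move (fwd (inj₁ refl)) = cross (x∉ refl)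
    move (fwd (inj₂ refl)) = R.step (inj₂ (x∉ refl , refl))
    move {z} (bwd (inj₁ refl)) = trans (sym z~x) (R.step (inj₂ (x∉ z~x , reverse² z)))
      where
      z~x : R.class (reverse z) ≡ R.class x
      z~x = R.step (inj₁ (cong rot (reverse² z)))
    move {z} (bwd (inj₂ refl)) = R.step (inj₂ (x∉ refl , reverse² z))

  data Content (r : Fin f) : Set where
    walled : (a : SDart) → R.class (proj₁ a) ≡ r → Content r
    empty  : (∀ d → T (Sd d) → R.class d ≢ r) → Content r

  content : ∀ r → Content r
  content r with any-dart? (λ d → T (Sd d) × R.class d ≡ r) (λ d → T? (Sd d) ×-dec (R.class d Fin.≟ r))
  ... | yes (d , p , eq) = walled (d , p) eq
  ... | no none          = empty λ d p eq → none (d , p , eq)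

  a₀ : Dart
  a₀ = dartOf e₀

  -- A region bounded by S has twelve darts of S; a region without darts of S is
  -- a whole component of G, and not that of a₀.
  12f≤ : (f + 1) * 12 ≤ s + C * 12
  12f≤ = size-mono (size-× (size-⊎ (↔-id _) size-⊤) (↔-id _)) (size-⊎ (proj₂ s-size) (size-× (↔-id _) (↔-id _)))
    place (λ {x} {y} → place-injective x y)
    where
    placeIn : ∀ {r} → Content r → Fin 12 → SDart ⊎ (Fin C × Fin 12)
    placeIn (walled a _)   i = inj₁ (Walk.walk a (toℕ i))
    placeIn {r} (empty _)  i = inj₂ (CC.class (R.rep r) , i)
    place : (Fin f ⊎ ⊤) × Fin 12 → SDart ⊎ (Fin C × Fin 12)
    place (inj₁ r , i)  = placeIn (content r) i
    -- The component of `a₀` contains a dart of `S`, so no empty region uses it. This spare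
    -- component makes `sparse` strict.
    place (inj₂ tt , i) = inj₂ (CC.class a₀ , i)
    alone : ∀ {r y} → (∀ d → T (Sd d) → R.class d ≢ r) → CC.class (R.rep r) ≡ CC.class y → r ≡ R.class y
    alone {r} none eq = trans (sym (R.class-rep r))
      (empty-region (λ d p eq′ → none d p (trans eq′ (R.class-rep r))) (CC.≡⇒~ eq))
    same-region : ∀ {r r′ i j} (k : Content r) (k′ : Content r′) → placeIn k i ≡ placeIn k′ j → r ≡ r′
    same-region {i = i} {j} (walled a eq) (walled b eq′) p =
      trans (sym eq) (trans (sym (Walk.region a (toℕ i))) (trans (cong (R.class ∘ proj₁) (inj₁-injective p)) (trans (Walk.region b (toℕ j)) eq′)))
    same-region {r′ = r′} (empty none) (empty _) p = trans (alone none (,-injectiveˡ (inj₂-injective p))) (R.class-rep r′)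
    same-region (walled _ _) (empty _) ()
    same-region (empty _) (walled _ _) ()
    same-index : ∀ {r i j} (k : Content r) → placeIn k i ≡ placeIn k j → i ≡ j
    same-index (walled a _) p = Walk.walk-injective a _ _ (cong proj₁ (inj₁-injective p))
    same-index (empty _)    p = ,-injectiveʳ (inj₂-injective p)
    not-a₀ : ∀ {r i j} (k : Content r) → placeIn k i ≢ inj₂ (CC.class a₀ , j)
    not-a₀ (walled _ _) ()
    not-a₀ (empty none) p = none a₀ e₀ (sym (alone none (,-injectiveˡ (inj₂-injective p))))
    place-injective : ∀ x y → place x ≡ place y → x ≡ y
    place-injective (inj₁ r , i) (inj₁ r′ , j) p with same-region (content r) (content r′) p
    ... | refl = cong (inj₁ r ,_) (same-index (content r) p)
    place-injective (inj₁ r , i) (inj₂ tt , j) p = contradiction p (not-a₀ (content r))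
    place-injective (inj₂ tt , i) (inj₁ r , j) p = contradiction (sym p) (not-a₀ (content r))
    place-injective (inj₂ tt , i) (inj₂ tt , j) p = cong (inj₂ tt ,_) (,-injectiveʳ (inj₂-injective p))

  -- Six times the Euler bound contains 12 f, which `12f≤` trades for darts. With `V≤` the terms in
  -- `c` and `C` cancel, leaving 5 s + 12 ≤ 12 n.
  sparse : 5 * sum δ ℕ.< 12 * count support
  sparse = ℕ.≤-trans (s≤s (ℕ.*-monoʳ-≤ 5 sum-δ≤s)) (ℕ.≤-trans (ℕ.+-monoˡ-≤ (5 * s) {1} {12} (s≤s z≤n)) 12+5s≤)
    where
    open +-*-Solver
    n₁ = count support
    12+5s≤ : 12 + 5 * s ≤ 12 * n₁
    12+5s≤ = ℕ.+-cancelʳ-≤ (s + 12 * c + 12 * C) _ _ (begin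
      12 + 5 * s + (s + 12 * c + 12 * C)
        ≡⟨ solve 3 (λ s c d → con 12 :+ con 5 :* s :+ (s :+ con 12 :* c :+ con 12 :* d) := con 12 :+ con 6 :* (s :+ con 2 :* (c :+ d))) refl s c C ⟩
      12 + 6 * (s + 2 * (c + C))      ≤⟨ ℕ.+-monoʳ-≤ 12 (ℕ.*-monoʳ-≤ 6 submap) ⟩
      12 + 6 * (2 * (V + f))          ≤⟨ ℕ.+-monoʳ-≤ 12 (ℕ.*-monoʳ-≤ 6 (ℕ.*-monoʳ-≤ 2 (ℕ.+-monoˡ-≤ f V≤))) ⟩
      12 + 6 * (2 * (c + n₁ + f))
        ≡⟨ solve 3 (λ c n f → con 12 :+ con 6 :* (con 2 :* (c :+ n :+ f)) := con 12 :* c :+ con 12 :* n :+ (f :+ con 1) :* con 12) refl c n₁ f ⟩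
      12 * c + 12 * n₁ + (f + 1) * 12 ≤⟨ ℕ.+-monoʳ-≤ (12 * c + 12 * n₁) 12f≤ ⟩
      12 * c + 12 * n₁ + (s + C * 12)
        ≡⟨ solve 4 (λ c n s d → con 12 :* c :+ con 12 :* n :+ (s :+ d :* con 12) := con 12 :* n :+ (s :+ con 12 :* c :+ con 12 :* d)) refl c n₁ s C ⟩
      12 * n₁ + (s + 12 * c + 12 * C) ∎)
      where open ℕ.≤-Reasoning

-- The induction

delete-smaller : ∀ {n} {S : Fin n → Fin n → Bool} {W w y} → w ∈ W → T (S w y) →
                 suc (sum (count ∘ delete S W)) ≤ sum (count ∘ S)
delete-smaller {n} {S} {W} {w} {y} w∈ e = size-mono
  (size-⊎ size-⊤ (size-Σ (size-count ∘ delete S W))) (size-Σ (size-count ∘ S))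
  (λ { (inj₁ tt) → w , y , e ; (inj₂ (u , v , p)) → u , v , proj₁ (delete⁻ p) })
  λ { {inj₁ tt} {inj₁ tt} _ → refl
    ; {inj₁ tt} {inj₂ (u , v , p)} eq → contradiction (subst (_∈ W) (cong proj₁ eq) w∈) (proj₁ (proj₂ (delete⁻ p)))
    ; {inj₂ (u , v , p)} {inj₁ tt} eq → contradiction (subst (_∈ W) (sym (cong proj₁ eq)) w∈) (proj₁ (proj₂ (delete⁻ p)))
    ; {inj₂ (u , v , p)} {inj₂ (u′ , v′ , p′)} eq → cong inj₂ (ΣΣ-T-≡ (cong proj₁ eq) (cong (proj₁ ∘ proj₂) eq)) }

module Induction (G : Graph) (subcubic : Subcubic G) (planar : Planar G) (girth : GirthAtLeast 12 G) where

  open Graph G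
  open Trails G

  module Step (S : Vertex → Vertex → Bool) (S-sym : ∀ {x y} → T (S x y) → T (S y x))
    (S⊆ : ∀ {x y} → T (S x y) → Adj x y)
    (smaller : ∀ {W w y} → w ∈ W → T (S w y) → Coloring (λ x y → T (delete S W x y))) where

    deg≤3 : ∀ v → count (S v) ≤ 3
    deg≤3 v = ℕ.≤-trans (count-mono {P = S v} {adj v} S⊆) (ℕ.≤-trans (ℕ.≤-reflexive (count-tabulate (adj v))) (subcubic v))

    open Reduction S S-sym deg≤3 smaller
    open Discharge S S-sym deg≤3 hiding (E)

    irrefl : ∀ {u v} → E u v → u ≢ v
    irrefl e refl = adj-irrefl _ (S⊆ e)

    unique : ∀ {xs} → Trail xs → length xs ≤ 12 → Unique xs
    unique = trail-unique girth

    two-nbrs : ∀ {v p q} → δ v ≡ 2 → E v p → E v q → p ≢ q → Nbrs v (p ∷ q ∷ [])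
    two-nbrs {v} δ≡2 vp vq p≢q = count-cover (S v) ((p≢q ∷ []) ∷ [] ∷ []) (vp ∷ vq ∷ []) (ℕ.≤-reflexive δ≡2)

    three-nbrs : ∀ {v p q r} → δ v ≡ 3 → E v p → E v q → E v r → p ≢ q → p ≢ r → q ≢ r → Nbrs v (p ∷ q ∷ r ∷ [])
    three-nbrs {v} δ≡3 vp vq vr p≢q p≢r q≢r =
      count-cover (S v) ((p≢q ∷ p≢r ∷ []) ∷ (q≢r ∷ []) ∷ [] ∷ []) (vp ∷ vq ∷ vr ∷ []) (ℕ.≤-reflexive δ≡3)

    leaf : ∀ {v} → δ v ≡ 1 → Coloring E
    leaf {v} δ≡1 with count-fresh (S v) [] (ℕ.≤-reflexive (sym δ≡1))
    ... | u , vu , _ = reduce-leaf (≢-sym (irrefl vu)) vu (count-cover (S v) ([] ∷ []) (vu ∷ []) (ℕ.≤-reflexive δ≡1))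

    path : Path₃ → Coloring E
    path (a , b , c , ab , bc , a≢c , δa , δb , δc) with second-nbr δa ab | second-nbr δc (S-sym bc)
    ... | x , ax , x≢b , _ | y , cy , y≢b , _ = reduce-path
      (unique (cons (S⊆ (S-sym ax)) x≢b (cons (S⊆ ab) a≢c (cons (S⊆ bc) (≢-sym y≢b) (last (S⊆ cy))))) (ℕ.m≤m+n 5 7))
      ax cy (two-nbrs δa ax ab x≢b) (two-nbrs δb (S-sym ab) bc a≢c) (two-nbrs δc (S-sym bc) cy (≢-sym y≢b))

    star₂₂ : Star₂₂ → Coloring E
    star₂₂ (v , a , b , δv , a≢b , ((va , δa) , a′ , aa′ , a′≢v , δa′) , ((vb , δb) , b′ , bb′ , b′≢v , δb′))
      with second-nbr δa′ (S-sym aa′) | second-nbr δb′ (S-sym bb′) | count-fresh (S v) (a ∷ b ∷ []) (ℕ.≤-reflexive (sym δv))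
    -- The trails from `x` to `u` and from `u` to `y` separate `u` from both threads; the trail from
    -- `x` to `y` does not pass through `u`.
    ... | x , a′x , x≢a , _ | y , b′y , y≢b , _ | u , vu , u∉ with
        unique (cons (S⊆ (S-sym a′x)) x≢a (cons (S⊆ (S-sym aa′)) a′≢v (cons (S⊆ (S-sym va)) (u∉ ∘ here ∘ sym) (last (S⊆ vu))))) (ℕ.m≤m+n 5 7)
      | unique (cons (S⊆ (S-sym vu)) (u∉ ∘ there ∘ here) (cons (S⊆ vb) (≢-sym b′≢v) (cons (S⊆ bb′) (≢-sym y≢b) (last (S⊆ b′y))))) (ℕ.m≤m+n 5 7)
    ... | (_ ∷ _ ∷ _ ∷ x≢u ∷ []) ∷ (_ ∷ _ ∷ a′≢u ∷ []) ∷ (_ ∷ a≢u ∷ []) ∷ _ | (u≢v ∷ u≢b ∷ u≢b′ ∷ u≢y ∷ []) ∷ _ =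
      reduce₂₂
        (unique (cons (S⊆ (S-sym a′x)) x≢a (cons (S⊆ (S-sym aa′)) a′≢v (cons (S⊆ (S-sym va)) a≢b
          (cons (S⊆ vb) (≢-sym b′≢v) (cons (S⊆ bb′) (≢-sym y≢b) (last (S⊆ b′y))))))) (ℕ.m≤m+n 7 5))
        (≢-sym x≢u ∷ ≢-sym a′≢u ∷ ≢-sym a≢u ∷ u≢v ∷ u≢b ∷ u≢b′ ∷ u≢y ∷ [])
        a′x b′y vu
        (two-nbrs δa′ a′x (S-sym aa′) x≢a) (two-nbrs δa aa′ (S-sym va) a′≢v)
        (two-nbrs δb′ b′y (S-sym bb′) y≢b) (two-nbrs δb bb′ (S-sym vb) b′≢v)
        (three-nbrs δv va vb vu a≢b a≢u (≢-sym u≢b))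

    star₁₁₂ : Star₁₁₂ → Coloring E
    star₁₁₂ (v , a , b , c , δv , a≢b , a≢c , b≢c , ((va , δa) , a′ , aa′ , a′≢v , δa′) , (vb , δb) , (vc , δc))
      with second-nbr δa′ (S-sym aa′) | second-nbr δb (S-sym vb) | second-nbr δc (S-sym vc)
    -- There is one trail through `v` for each pair of threads, so any two vertices of the
    -- configuration lie on a common trail.
    ... | x , a′x , x≢a , _ | y , by , y≢v , _ | z , cz , z≢v , _ = reduce₁₁₂
      (unique (arm a≢b (cons (S⊆ vb) (≢-sym y≢v) (last (S⊆ by)))) (ℕ.m≤m+n 6 6))
      (unique (arm a≢c (cons (S⊆ vc) (≢-sym z≢v) (last (S⊆ cz)))) (ℕ.m≤m+n 6 6))
      (unique (cons (S⊆ (S-sym by)) y≢v (cons (S⊆ (S-sym vb)) b≢c (cons (S⊆ vc) (≢-sym z≢v) (last (S⊆ cz))))) (ℕ.m≤m+n 5 7))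
      a′x by cz
      (two-nbrs δa′ a′x (S-sym aa′) x≢a) (two-nbrs δa aa′ (S-sym va) a′≢v)
      (two-nbrs δb by (S-sym vb) y≢v) (two-nbrs δc cz (S-sym vc) z≢v)
      (three-nbrs δv va vb vc a≢b a≢c b≢c)
      where
      arm : ∀ {w ws} → a ≢ w → Trail (v ∷ w ∷ ws) → Trail (x ∷ a′ ∷ a ∷ v ∷ w ∷ ws)
      arm a≢w t = cons (S⊆ (S-sym a′x)) x≢a (cons (S⊆ (S-sym aa′)) a′≢v (cons (S⊆ (S-sym va)) a≢w t))

    no-edges : (¬ ∃₂ λ u v → E u v) → Coloring E
    no-edges none = record
      { pal = λ _ → palette zero (suc zero) (λ ())
      ; κ = λ _ _ → nothing
      ; κ-sym = λ _ → refl
      ; κ-pal = λ _ → zero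
      ; proper = λ e → contradiction (_ , _ , e) none
      ; compatible = λ e → contradiction (_ , _ , e) none }

    impossible : (∀ v → δ v ≢ 1) → ¬ Path₃ → ¬ Star₂₂ → ¬ Star₁₁₂ → ∀ {u v} → ¬ E u v
    impossible no-leaf no-path no₂₂ no₁₁₂ e =
      ℕ.<⇒≱ (Sparse.sparse G planar girth S S-sym S⊆ go-on e) (discharge no-leaf no-path no₂₂ no₁₁₂)
      where
      go-on : ∀ {u v} → E u v → ∃ λ w → E v w × w ≢ u
      go-on {u} {v} uv with count-fresh (S v) (u ∷ []) 1<δ
        where
        1<δ : 1 ℕ.< δ v
        1<δ = ℕ.≤∧≢⇒< (unique⇒length≤count (S v) ([] ∷ []) (S-sym uv ∷ [])) (≢-sym (no-leaf v))
      ... | w , vw , w∉ = w , vw , w∉ ∘ here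

    colored : Coloring E
    colored with any? (λ v → δ v ℕ.≟ 1)
    ... | yes (_ , δ≡1) = leaf δ≡1
    ... | no no-leaf with path₃?
    ...   | yes p = path p
    ...   | no no-path with star₂₂?
    ...     | yes p = star₂₂ p
    ...     | no no₂₂ with star₁₁₂?
    ...       | yes p = star₁₁₂ p
    ...       | no no₁₁₂ = no-edges λ (_ , _ , e) → impossible (λ v eq → no-leaf (v , eq)) no-path no₂₂ no₁₁₂ e

  submap-coloring : ∀ m (S : Vertex → Vertex → Bool) → (∀ {x y} → T (S x y) → T (S y x)) →
                    (∀ {x y} → T (S x y) → Adj x y) → sum (count ∘ S) ℕ.< m → Coloring (λ x y → T (S x y))
  submap-coloring (suc m) S S-sym S⊆ (s≤s μ≤m) = Step.colored S S-sym S⊆ λ {W} w∈ e →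
    submap-coloring m (delete S W)
      (delete-sym S S-sym W)
      (S⊆ ∘ proj₁ ∘ delete⁻ {S = S} {W})
      (ℕ.<-≤-trans (delete-smaller w∈ e) μ≤m)

  coloring : Coloring Adj
  coloring = submap-coloring _ adj adj-sym id (ℕ.n<1+n _)

-- From palettes to a packing edge-colouring

module _ (G : Graph) where
  open Graph G
  open Edge

  edge-≡ : {e f : Edge} → lo e ≡ lo f → hi e ≡ hi f → e ≡ f
  edge-≡ {e} {f} refl refl = cong₂ (λ p q → record { lo = lo e ; hi = hi e ; lo<hi = p ; adjacent = q })
    (ℕ.<-irrelevant _ _) (T-irrelevant _ _)

  data Ends (e : Edge) : Vertex → Vertex → Set where
    up   : Ends e (lo e) (hi e)
    down : Ends e (hi e) (lo e)

  ends : ∀ {e v} → v ∈ᵉ e → ∃ (Ends e v)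
  ends (inj₁ refl) = _ , up
  ends (inj₂ refl) = _ , down

  ends-adj : ∀ {e v w} → Ends e v w → Adj v w
  ends-adj {e} up   = adjacent e
  ends-adj {e} down = adj-sym (adjacent e)

  ends-other : ∀ {e v w x} → Ends e v w → x ∈ᵉ e → x ≢ v → x ≡ w
  ends-other up   (inj₁ eq) x≢v = contradiction eq x≢v
  ends-other up   (inj₂ eq) _   = eq
  ends-other down (inj₁ eq) _   = eq
  ends-other down (inj₂ eq) x≢v = contradiction eq x≢v

  ends-injective : ∀ {e f v w} → Ends e v w → Ends f v w → e ≡ f
  ends-injective {e} {f} p q = go p q refl refl
    where
    go : ∀ {v w v′ w′} → Ends e v w → Ends f v′ w′ → v ≡ v′ → w ≡ w′ → e ≡ f
    go up   up   p q = edge-≡ p q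
    go down down p q = edge-≡ q p
    go up   down p q = contradiction (lo<hi f) (ℕ.<-asym (subst₂′ p q))
      where
      subst₂′ : lo e ≡ hi f → hi e ≡ lo f → hi f < lo f
      subst₂′ refl refl = lo<hi e
    go down up   p q = contradiction (lo<hi f) (ℕ.<-asym (subst₂′ q p))
      where
      subst₂′ : lo e ≡ hi f → hi e ≡ lo f → hi f < lo f
      subst₂′ refl refl = lo<hi e

  -- Only short walks in the line graph have to be excluded: those of length one by properness, and
  -- those of length two by `linked`.
  packing : Coloring Adj → PackingEdgeColoring 1 5 G
  packing X = record
    { color = encode ∘ shade′
    ; matching = λ { i p q e≢f ε → contradiction refl e≢f
                   ; i p q e≢f ((_ , _ , v∈e , v∈f) ◅ ε) → contradiction (share v∈e v∈f (encode-injective (trans p (sym q)))) e≢f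
                   ; i p q e≢f (_ ◅ _ ◅ _) → s≤s (s≤s z≤n) }
    ; inducedMatching = λ { i p q e≢f ε → contradiction refl e≢f
                   ; i p q e≢f ((_ , _ , v∈e , v∈f) ◅ ε) → contradiction (share v∈e v∈f (encode-injective (trans p (sym q)))) e≢f
                   ; i p q e≢f ((e≢g , _ , v∈e , v∈g) ◅ (g≢f , _ , w∈g , w∈f) ◅ ε) →
                       contradiction (linked (encode-just p) (encode-just q) e≢f e≢g v∈e v∈g w∈g w∈f) id
                   ; i p q e≢f (_ ◅ _ ◅ _ ◅ _) → s≤s (s≤s (s≤s z≤n)) }
    }
    where
    encode : Color → Fin 1 ⊎ Fin 5
    encode nothing  = inj₁ zero
    encode (just s) = inj₂ s
    encode-injective : ∀ {c d} → encode c ≡ encode d → c ≡ d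
    encode-injective {nothing} {nothing} _    = refl
    encode-injective {just _}  {just _}  refl = refl
    encode-just : ∀ {c s} → encode c ≡ inj₂ s → c ≡ just s
    encode-just {just _} refl = refl
    shade′ : Edge → Color
    shade′ e = κ X (lo e) (hi e)
    shade-ends : ∀ {e v w} → Ends e v w → shade′ e ≡ κ X v w
    shade-ends up           = refl
    shade-ends {e} down = κ-sym X (adjacent e)
    share : ∀ {e f v} → v ∈ᵉ e → v ∈ᵉ f → shade′ e ≡ shade′ f → e ≡ f
    share {e} {f} {v} v∈e v∈f eq with ends {e} v∈e | ends {f} v∈f
    ... | x , p | y , q with proper X (ends-adj p) (ends-adj q) (trans (sym (shade-ends p)) (trans eq (shade-ends q)))
    ... | refl = ends-injective p q
    strong : ∀ {e v s} → v ∈ᵉ e → shade′ e ≡ just s → s ∈ₚ pal X v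
    strong {e} {v} {s} v∈e eq with ends {e} v∈e
    ... | x , p = inside (subst (_∈⁰ pal X v) (trans (sym (shade-ends p)) eq) (κ-pal X (ends-adj p)))
      where
      inside : just s ∈⁰ pal X v → s ∈ₚ pal X v
      inside (pick s∈) = s∈
    -- The common strong colour lies in the palettes at both ends of `g`, so compatibility gives it
    -- to `g` too, against properness at `v`.
    linked : ∀ {e f g v w s} → shade′ e ≡ just s → shade′ f ≡ just s → e ≢ f → e ≢ g →
             v ∈ᵉ e → v ∈ᵉ g → w ∈ᵉ g → w ∈ᵉ f → ⊥
    linked {e} {f} {g} {v} {w} p q e≢f e≢g v∈e v∈g w∈g w∈f with w Fin.≟ v
    ... | yes refl = e≢f (share v∈e w∈f (trans p (sym q)))
    ... | no w≢v with ends {g} v∈g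
    ...   | x , r with ends-other r w∈g w≢v
    ...     | refl = e≢g (share v∈e v∈g (trans p (trans (compatible X (ends-adj r) (strong {e} v∈e p) (strong {f} w∈f q)) (sym (shade-ends r)))))

theorem1p1 : (G : Graph) → Subcubic G → Planar G → GirthAtLeast 12 G → PackingEdgeColoring 1 5 G
theorem1p1 G subcubic planar girth = packing G (Induction.coloring G subcubic planar girth)
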